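{- Let $T$ be the tree with $6$ vertices obtained from the claw $K_{1,3}$ by subdividing two of its edges each with one new vertex. The problem PERFECT MATCHING CUT is solvable in polynomial time when restricted to $T$-free graphs.
   Context: Graphs are finite, simple and undirected. A cut of a graph $G=(V,E)$ is a partition $V=X\cup Y$ of the vertex set into disjoint non-empty sets $X,Y$; its edge cut $E(X,Y)$ is the set of all edges with one endvertex in $X$ and the other in $Y$. A perfect matching cut of $G$ is an edge cut $E(X,Y)$ that is a perfect matching of $G$; equivalently, every vertex of $X$ has exactly one neighbor in $Y$ and every vertex of $Y$ has exactly one neighbor in $X$. PERFECT MATCHING CUT is the problem of deciding whether a given graph has a perfect matching cut. For a fixed graph $H$, a graph $G$ is $H$-free if $G$ contains no induced subgraph isomorphic to $H$. Explicitly, $T$ consists of a path on vertices $a,b,c,d,e$ (in this order) together with one further vertex $f$ adjacent only to $c$. -}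

module Defs where

open import Data.Bool.Base using (Bool; true; false; _∧_; _∨_)
open import Data.Bool.ListAction using (any)
open import Data.Bool.Properties using () renaming (_≟_ to _≟ᵇ_)
open import Data.Fin.Base using (Fin; zero)
open import Data.Fin.Patterns using (0F; 1F; 2F; 3F; 4F; 5F)
open import Data.Fin.Properties using (all?) renaming (_≟_ to _≟ᶠ_)
open import Data.Fin.Subset using (Subset; _∈_; _∩_; Nonempty; Empty)
open import Data.List.Base using (List; []; _∷_; tabulate)
open import Data.Nat.Base using (ℕ; suc; _+_; _*_; _^_; _≤_)
open import Data.Product using (Σ; ∃; ∃-syntax; ∃!; _×_; _,_; proj₁)
open import Data.Sum.Base using (_⊎_; inj₁; inj₂)
open import Data.Vec.Base using (Vec; _∷_; lookup; replicate; _[_]≔_)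
open import Function.Definitions using (Injective)
open import Relation.Binary.PropositionalEquality using (_≡_; trans)
open import Relation.Nullary using (¬_; Reflects; does)
open import Relation.Nullary.Decidable using (from-yes)

record Graph : Set where
  field
    order : ℕ

  Vertex : Set
  Vertex = Fin order

  field
    adj         : Vertex → Vertex → Bool
    symmetric   : ∀ u v → adj u v ≡ adj v u
    irreflexive : ∀ v → adj v v ≡ false

  Adj : Vertex → Vertex → Set
  Adj u v = adj u v ≡ true

open Graph

record EdgeSet (G : Graph) : Set₁ where
  field
    member    : Vertex G → Vertex G → Set
    symmetric : ∀ {u v} → member u v → member v u
    edges     : ∀ {u v} → member u v → Adj G u v

IsPerfectMatching : (G : Graph) → EdgeSet G → Set
IsPerfectMatching G M = ∀ v → ∃! _≡_ λ u → EdgeSet.member M v u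

record Cut (G : Graph) : Set where
  field
    X Y       : Subset (order G)
    nonemptyX : Nonempty X
    nonemptyY : Nonempty Y
    disjoint  : Empty (X ∩ Y)
    cover     : ∀ v → v ∈ X ⊎ v ∈ Y

edgeCut : (G : Graph) → Cut G → EdgeSet G
edgeCut G C = record
  { member    = λ u v → Adj G u v × (u ∈ X × v ∈ Y ⊎ u ∈ Y × v ∈ X)
  ; symmetric = λ { {u} {v} (uv , inj₁ (u∈X , v∈Y)) → trans (Graph.symmetric G v u) uv , inj₂ (v∈Y , u∈X)
                  ; {u} {v} (uv , inj₂ (u∈Y , v∈X)) → trans (Graph.symmetric G v u) uv , inj₁ (v∈X , u∈Y) }
  ; edges     = proj₁
  }
  where open Cut C

HasPerfectMatchingCut : Graph → Set
HasPerfectMatchingCut G = ∃ λ (C : Cut G) → IsPerfectMatching G (edgeCut G C)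

-- An isomorphism of H onto the subgraph of G induced by the image of
-- the embedding.
record InducedCopy (H G : Graph) : Set where
  field
    embed     : Vertex H → Vertex G
    injective : Injective _≡_ _≡_ embed
    preserves : ∀ u v → adj G (embed u) (embed v) ≡ adj H u v

_-Free : Graph → Graph → Set
(H -Free) G = ¬ InducedCopy H G

-- The path a b c d e = 0 1 2 3 4 together with f = 5 attached to c = 2.
T : Graph
T = record
  { order       = 6
  ; adj         = adjT
  ; symmetric   = from-yes (all? λ u → all? λ v → adjT u v ≟ᵇ adjT v u)
  ; irreflexive = from-yes (all? λ v → adjT v v ≟ᵇ false)
  }
  where
  _==_ : Fin 6 → Fin 6 → Bool
  u == v = does (u ≟ᶠ v)

  edgesT : List (Fin 6 × Fin 6)
  edgesT = (0F , 1F) ∷ (1F , 2F) ∷ (2F , 3F) ∷ (3F , 4F) ∷ (2F , 5F) ∷ []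

  adjT : Fin 6 → Fin 6 → Bool
  adjT u v = any (λ (x , y) → (u == x ∧ v == y) ∨ (u == y ∧ v == x)) edgesT

-- The model of computation is the language WHILE over binary trees of
-- N. D. Jones, "Computability and Complexity from a Programming
-- Perspective" (1997), with `if` added as a primitive and unit costs for
-- all expression nodes and commands.  Every primitive acts on the root
-- of a tree only, so with shared subtrees each takes constant time, and
-- the polynomial-time decidable problems are those of Turing machines.

infixr 5 _∙_

data Tree : Set where
  nil : Tree
  _∙_ : Tree → Tree → Tree

size : Tree → ℕ
size nil     = 1
size (s ∙ t) = suc (size s + size t)

head tail : Tree → Tree
head nil     = nil
head (s ∙ t) = s
tail nil     = nil
tail (s ∙ t) = t

data Expr (k : ℕ) : Set where
  var   : Fin k → Expr k
  nil   : Expr k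
  cons  : Expr k → Expr k → Expr k
  hd tl : Expr k → Expr k

infix  7 _≔_
infix  6 if_then_else_ while_loop_
infixr 5 _⨾_

data Cmd (k : ℕ) : Set where
  skip          : Cmd k
  _≔_           : Fin k → Expr k → Cmd k
  _⨾_           : Cmd k → Cmd k → Cmd k
  if_then_else_ : Expr k → Cmd k → Cmd k → Cmd k
  while_loop_   : Expr k → Cmd k → Cmd k

Store : ℕ → Set
Store k = Vec Tree k

⟦_⟧ : ∀ {k} → Expr k → Store k → Tree
⟦ var x ⟧    σ = lookup σ x
⟦ nil ⟧      σ = nil
⟦ cons e f ⟧ σ = ⟦ e ⟧ σ ∙ ⟦ f ⟧ σ
⟦ hd e ⟧     σ = head (⟦ e ⟧ σ)
⟦ tl e ⟧     σ = tail (⟦ e ⟧ σ)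

cost : ∀ {k} → Expr k → ℕ
cost (var x)    = 1
cost nil        = 1
cost (cons e f) = suc (cost e + cost f)
cost (hd e)     = suc (cost e)
cost (tl e)     = suc (cost e)

infix 4 ⟨_,_⟩⇓[_]_

-- ⟨ c , σ ⟩⇓[ t ] σ′: started in store σ, the command c terminates in
-- store σ′ after exactly t time units.  In tests, nil means false and
-- every other tree means true.
data ⟨_,_⟩⇓[_]_ {k : ℕ} : Cmd k → Store k → ℕ → Store k → Set where
  skip⇓   : ∀ {σ} → ⟨ skip , σ ⟩⇓[ 1 ] σ
  assign⇓ : ∀ {σ x e} →
            ⟨ x ≔ e , σ ⟩⇓[ suc (cost e) ] (σ [ x ]≔ ⟦ e ⟧ σ)
  seq⇓    : ∀ {σ σ′ σ″ c d s t} →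
            ⟨ c , σ ⟩⇓[ s ] σ′ → ⟨ d , σ′ ⟩⇓[ t ] σ″ →
            ⟨ c ⨾ d , σ ⟩⇓[ suc (s + t) ] σ″
  then⇓   : ∀ {σ σ′ e c d t l r} → ⟦ e ⟧ σ ≡ l ∙ r →
            ⟨ c , σ ⟩⇓[ t ] σ′ →
            ⟨ if e then c else d , σ ⟩⇓[ suc (cost e + t) ] σ′
  else⇓   : ∀ {σ σ′ e c d t} → ⟦ e ⟧ σ ≡ nil →
            ⟨ d , σ ⟩⇓[ t ] σ′ →
            ⟨ if e then c else d , σ ⟩⇓[ suc (cost e + t) ] σ′
  exit⇓   : ∀ {σ e c} → ⟦ e ⟧ σ ≡ nil →
            ⟨ while e loop c , σ ⟩⇓[ suc (cost e) ] σ
  loop⇓   : ∀ {σ σ′ σ″ e c s t l r} → ⟦ e ⟧ σ ≡ l ∙ r →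
            ⟨ c , σ ⟩⇓[ s ] σ′ → ⟨ while e loop c , σ′ ⟩⇓[ t ] σ″ →
            ⟨ while e loop c , σ ⟩⇓[ suc (cost e + (s + t)) ] σ″

-- Variable zero holds the input at the start and the output at the end.
record Program : Set where
  field
    auxiliaries : ℕ
    body        : Cmd (suc auxiliaries)

Computes_↦_within_ : Program → Tree → Tree → ℕ → Set
Computes_↦_within_ p input output bound =
  ∃[ t ] ∃[ σ ] (⟨ body , input ∷ replicate auxiliaries nil ⟩⇓[ t ] σ)
              × lookup σ zero ≡ output × t ≤ bound
  where open Program p

codeBool : Bool → Tree
codeBool false = nil
codeBool true  = nil ∙ nil

codeList : List Tree → Tree
codeList []       = nil
codeList (t ∷ ts) = t ∙ codeList ts

record Problem : Set₁ where
  field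
    Instance : Set
    code     : Instance → Tree
    Yes      : Instance → Set

-- Restriction to the instances satisfying P; nothing is required of an
-- algorithm on other inputs.
_↾_ : (Π : Problem) → (Problem.Instance Π → Set) → Problem
Π ↾ P = record
  { Instance = Σ Instance P
  ; code     = λ (x , _) → code x
  ; Yes      = λ (x , _) → Yes x
  }
  where open Problem Π

-- Sizes are at least 1, so every polynomial in the size is bounded by
-- some a * size ^ d.
PolynomialTime : Problem → Set
PolynomialTime Π =
  ∃[ p ] ∃[ a ] ∃[ d ] ∀ (x : Instance) →
    ∃[ b ] Computes_↦_within_ p (code x) (codeBool b) (a * size (code x) ^ d)
         × Reflects (Yes x) b
  where open Problem Π

-- The adjacency matrix, as the list of its rows.
codeGraph : Graph → Tree
codeGraph G =
  codeList (tabulate λ u → codeList (tabulate λ v → codeBool (adj G u v)))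

PERFECT-MATCHING-CUT : Problem
PERFECT-MATCHING-CUT = record
  { Instance = Graph
  ; code     = codeGraph
  ; Yes      = HasPerfectMatchingCut
  }

{-# OPTIONS --safe #-}
module Submission where

-- A perfect matching cut is a 2-colouring in which every vertex has exactly
-- one neighbour of the other colour, its partner.  For every vertex a, guess
-- a partner b and close ({a}, {b}) under rules that force colours.  Where the
-- rules stop, T-freeness leaves little: every uncoloured vertex next to a
-- coloured one has exactly two neighbours, one of either colour, and a
-- coloured vertex without partner has at least two uncoloured neighbours.
-- By counting, the colouring extends only if it always has exactly two.  Then
-- these vertices form even cycles, and colouring the uncoloured ones
-- alternately along them settles the whole component of a.
--
-- The resulting criterion is a first-order formula with a fixed point, which
-- is evaluated by loops over the rows of the adjacency matrix only; its nesting
-- depth therefore gives the exponent of the polynomial.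

open import Defs
open import Data.Bool.Base using (Bool; true; false; not)
open import Data.Bool.Properties using (not-involutive; ¬-not; not-¬) renaming (_≟_ to _≟ᵇ_)
open import Data.Empty using (⊥; ⊥-elim)
open import Data.Fin.Base as Fin using (Fin; zero; suc; toℕ; fromℕ; fromℕ<)
open import Data.Fin.Patterns using (0F; 1F; 2F; 3F; 4F; 5F)
open import Data.Fin.Properties using (any?; all?; toℕ-fromℕ<; toℕ<n; toℕ-injective; pigeonhole; <⇒≢) renaming (_≟_ to _≟ᶠ_)
open import Data.Fin.Subset using (Subset; ∣_∣) renaming (_∈_ to _∈ˢ_)
open import Data.Fin.Subset.Properties using (x∈p∩q⁺; x∈p∩q⁻; ∣p∣≤n)
import Data.List.Base as List
open import Data.Nat.Base using (ℕ; zero; suc; _+_; _*_; _∸_; _^_; _≤_; _<_; z≤n; s≤s; s≤s⁻¹)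
open import Data.Nat.Properties using
  ( _≟_; module ≤-Reasoning; ≤-refl; ≤-reflexive; ≤-trans; <⇒≤; <⇒≱; ≤∧≢⇒<; n≤1+n; n<1+n
  ; m≤m+n; m≤n+m; m≤n⇒m≤1+n; m≤n⇒m<n∨m≡n; +-assoc; +-comm; +-suc; +-mono-≤; +-monoʳ-≤; +-mono-<-≤; +-monoʳ-<
  ; *-assoc; *-comm; *-identityʳ; *-distribʳ-+; *-mono-≤; *-monoʳ-≤; ^-monoʳ-≤; ^-monoˡ-≤; n∸n≡0; +-∸-assoc )
open import Data.Product using (Σ; ∃; ∃!; ∃-syntax; _×_; _,_; proj₁; proj₂)
open import Data.Sum.Base using (_⊎_; inj₁; inj₂; [_,_]′; swap)
open import Data.Vec.Base using (Vec; []; _∷_; lookup; tabulate; replicate)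
open import Data.Vec.Properties using (lookup∘tabulate; []=⇒lookup; lookup⇒[]=; lookup-replicate)
open import Function.Base using (_∘_; id)
open import Function.Bundles using (_⇔_; mk⇔; Equivalence)
open import Relation.Binary.PropositionalEquality
open import Relation.Nullary using (¬_; Dec; yes; no; does; proof; contradiction)
open import Relation.Nullary.Decidable using (map; map′; _×-dec_; _⊎-dec_; _→-dec_; ¬?; dec-true; dec-false; decidable-stable; from-yes)

open Graph using (order; adj; irreflexive)

-- Every coloured vertex has a chain of reasons that leads back to a vertex with a coloured partner
-- or to a lock, a 4-cycle in which two opposite vertices have no further neighbours. `T`-freeness
-- cuts this chain short: a coloured vertex either is, or is next to, a vertex `q` with a neighbour
-- `r` that misses everything relevant. Then `r`, `q`, `c` begin an induced `T` as soon as an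
-- uncoloured path leaves `c`, unless there are extra edges; the rules `crossed`, `pair` and those
-- for locks are made for exactly these edges.
--
-- The count: call a coloured vertex without coloured partner open. In a cut that extends the state,
-- each open vertex has an uncoloured partner and at least one uncoloured neighbour of its own
-- colour. An uncoloured vertex next to an open one has one neighbour of either colour, hence one
-- partner and one neighbour of its own colour, both open. So there are as many such vertices as
-- open ones, and no open vertex can have two uncoloured neighbours of its own colour.
--
-- The guesses for different vertices need not agree: each yields a colouring of a union of
-- components, and these are combined component by component.

-- Loop terms and their compilation to WHILE

-- A tree with a spine of i cells stands for the number i.
len : Tree → ℕ
len nil     = 0
len (_ ∙ t) = suc (len t)

tails : ℕ → Tree → Tree
tails zero    t = t
tails (suc i) t = tails i (tail t)

foldTails : (Tree → Tree → Tree) → Tree → Tree → Tree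
foldTails f nil     acc = acc
foldTails f (_ ∙ r) acc = foldTails f r (f r acc)

-- Terms in an environment of suc k trees.  The last entry of the
-- environment is never shadowed, and all loops run over its tails, which
-- makes every term polynomial in the length of that entry.
data Tm (k : ℕ) : Set where
  exp  : Expr (suc k) → Tm k
  bind : Tm k → Tm (suc k) → Tm k
  cond : Expr (suc k) → Tm k → Tm k → Tm k
  loop : Tm k → Tm (2 + k) → Tm k

Env : ℕ → Set
Env k = Vec Tree (suc k)

input : ∀ {k} → Env k → Tree
input {k} ρ = lookup ρ (fromℕ k)

choose : Tree → Tree → Tree → Tree
choose nil     t u = u
choose (_ ∙ _) t u = t

ev : ∀ {k} → Tm k → Env k → Tree
ev (exp e)      ρ = ⟦ e ⟧ ρ
ev (bind t u)   ρ = ev u (ev t ρ ∷ ρ)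
ev (cond e t u) ρ = choose (⟦ e ⟧ ρ) (ev t ρ) (ev u ρ)
ev (loop t u)   ρ = foldTails (λ r acc → ev u (r ∷ acc ∷ ρ)) (input ρ) (ev t ρ)

-- Terms are compiled to commands with a single variable, which holds the
-- environment as a stack; the value of a term is pushed on top.
stack : ∀ {k} → Vec Tree k → Tree
stack []      = nil
stack (t ∷ ρ) = t ∙ stack ρ

S₀ : Expr 1
S₀ = var zero

drop : ℕ → Expr 1
drop zero    = S₀
drop (suc i) = tl (drop i)

entry : ∀ {k} → Expr k → Expr 1
entry (var i)    = hd (drop (toℕ i))
entry nil        = nil
entry (cons e f) = cons (entry e) (entry f)
entry (hd e)     = hd (entry e)
entry (tl e)     = tl (entry e)

compile : ∀ {k} → Tm k → Cmd 1
compile (exp e)      = zero ≔ cons (entry e) S₀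
compile (bind t u)   = compile t ⨾ compile u ⨾ zero ≔ cons (hd S₀) (tl (tl S₀))
compile (cond e t u) = if entry e then compile t else compile u
compile {k} (loop t u) =
  compile t ⨾
  zero ≔ cons (hd (drop (suc k))) S₀ ⨾
  while hd S₀ loop
    (zero ≔ cons (tl (hd S₀)) (tl S₀) ⨾
     compile u ⨾
     zero ≔ cons (hd (tl S₀)) (cons (hd S₀) (tl (tl (tl S₀))))) ⨾
  zero ≔ tl S₀

-- Built in the shape in which `_▹_` adds up costs, so that `correct` needs almost no arithmetic;
-- the constants are the costs of the stack operations. For `cond` the sum of both branches stands
-- in for their maximum.
bound : ∀ {k} → Tm k → ℕ → ℕ
bound (exp e)      n = suc (cost (cons (entry e) S₀))
bound (bind t u)   n = suc (bound t n + suc (bound u n + 7))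
bound (cond e t u) n = suc (cost (entry e) + (bound t n + bound u n))
bound {k} (loop t u) n =
  suc (bound t n + suc (suc (cost (cons (hd (drop (suc k))) S₀)) +
  suc (3 + n * (3 + suc (7 + suc (bound u n + 12))) + 3)))

record Run (c : Cmd 1) (s s′ : Tree) (b : ℕ) : Set where
  constructor run
  field
    {time} : ℕ
    exec   : ⟨ c , s ∷ [] ⟩⇓[ time ] (s′ ∷ [])
    time≤  : time ≤ b

assign : ∀ {e s s′} → ⟦ e ⟧ (s ∷ []) ≡ s′ → Run (zero ≔ e) s s′ (suc (cost e))
assign refl = run assign⇓ ≤-refl

infixr 5 _▹_
_▹_ : ∀ {c d s s′ s″ a b} → Run c s s′ a → Run d s′ s″ b → Run (c ⨾ d) s s″ (suc (a + b))
run p p≤ ▹ run q q≤ = run (seq⇓ p q) (s≤s (+-mono-≤ p≤ q≤))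

drop-tails : ∀ i s → ⟦ drop i ⟧ (s ∷ []) ≡ tails i s
drop-tails i s = go i s
  where
  tail-tails : ∀ i s → tail (tails i s) ≡ tails i (tail s)
  tail-tails zero    s = refl
  tail-tails (suc i) s = tail-tails i (tail s)
  go : ∀ i s → ⟦ drop i ⟧ (s ∷ []) ≡ tails i s
  go zero    s = refl
  go (suc i) s = trans (cong tail (go i s)) (tail-tails i s)

head-tails-stack : ∀ {k} (ρ : Vec Tree k) i → head (tails (toℕ i) (stack ρ)) ≡ lookup ρ i
head-tails-stack (t ∷ ρ) zero    = refl
head-tails-stack (t ∷ ρ) (suc i) = head-tails-stack ρ i

entry-correct : ∀ {k} (e : Expr k) ρ → ⟦ entry e ⟧ (stack ρ ∷ []) ≡ ⟦ e ⟧ ρ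
entry-correct (var i)    ρ = trans (cong head (drop-tails (toℕ i) (stack ρ))) (head-tails-stack ρ i)
entry-correct nil        ρ = refl
entry-correct (cons e f) ρ = cong₂ _∙_ (entry-correct e ρ) (entry-correct f ρ)
entry-correct (hd e)     ρ = cong head (entry-correct e ρ)
entry-correct (tl e)     ρ = cong tail (entry-correct e ρ)

input-correct : ∀ {k} (ρ : Env k) → head (⟦ drop k ⟧ (stack ρ ∷ [])) ≡ input ρ
input-correct {k} ρ =
  trans (cong head (drop-tails k (stack ρ))) (go ρ)
  where
  go : ∀ {k} (ρ : Env k) → head (tails k (stack ρ)) ≡ input ρ
  go {zero}  (t ∷ []) = refl
  go {suc k} (t ∷ ρ)  = go ρ

while-run : ∀ {c b} (f : Tree → Tree → Tree) {s} →
            (∀ t r acc → Run c ((t ∙ r) ∙ acc ∙ s) (r ∙ f r acc ∙ s) b) →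
            ∀ l acc → Run (while hd S₀ loop c) (l ∙ acc ∙ s) (nil ∙ foldTails f l acc ∙ s)
                          (3 + len l * (3 + b))
while-run f body nil     acc = run (exit⇓ refl) ≤-refl
while-run {b = b} f body (t ∙ r) acc with body t r acc | while-run f body r (f r acc)
... | run {p′} p p≤ | run {q′} q q≤ = run (loop⇓ refl p q) (begin
  3 + (p′ + q′)                           ≤⟨ +-monoʳ-≤ 3 (+-mono-≤ p≤ q≤) ⟩
  3 + (b + (3 + len r * (3 + b)))       ≡⟨ cong (3 +_) (sym (+-assoc b 3 _)) ⟩
  3 + (b + 3 + len r * (3 + b))         ≡⟨ cong (λ x → 3 + (x + len r * (3 + b))) (+-comm b 3) ⟩
  3 + (3 + b + len r * (3 + b))         ∎)
  where open ≤-Reasoning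

correct : ∀ {k} (t : Tm k) (ρ : Env k) →
          Run (compile t) (stack ρ) (ev t ρ ∙ stack ρ) (bound t (len (input ρ)))
correct (exp e) ρ = assign (cong (_∙ stack ρ) (entry-correct e ρ))
correct (bind t u) ρ =
  correct t ρ ▹ correct u (ev t ρ ∷ ρ) ▹ assign refl
correct (cond e t u) ρ with ⟦ e ⟧ ρ in eq
... | l ∙ r with correct t ρ
...   | run p p≤ = run (then⇓ (trans (entry-correct e ρ) eq) p)
                       (s≤s (+-monoʳ-≤ _ (≤-trans p≤ (m≤m+n _ _))))
correct (cond e t u) ρ | nil with correct u ρ
...   | run p p≤ = run (else⇓ (trans (entry-correct e ρ) eq) p)
                       (s≤s (+-monoʳ-≤ _ (≤-trans p≤ (m≤n+m _ _))))
correct (loop t u) ρ =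
  correct t ρ ▹
  assign (cong (_∙ ev t ρ ∙ stack ρ) (input-correct (ev t ρ ∷ ρ))) ▹
  while-run _ (λ _ r acc → assign refl ▹ correct u (r ∷ acc ∷ ρ) ▹ assign refl) (input ρ) (ev t ρ) ▹
  assign refl

-- Polynomial bounds on running times

Polynomial : (ℕ → ℕ) → Set
Polynomial f = ∃[ a ] ∃[ d ] ∀ n → f n ≤ a * suc n ^ d

const-poly : ∀ c → Polynomial (λ _ → c)
const-poly c = c , 0 , λ n → ≤-reflexive (sym (*-identityʳ c))

infixl 6 _+-poly_
_+-poly_ : ∀ {f g} → Polynomial f → Polynomial g → Polynomial (λ n → f n + g n)
_+-poly_ {f} {g} (a , d , f≤) (b , e , g≤) = a + b , d + e , λ n → begin
  f n + g n                             ≤⟨ +-mono-≤ (f≤ n) (g≤ n) ⟩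
  a * suc n ^ d + b * suc n ^ e         ≤⟨ +-mono-≤ (*-monoʳ-≤ a (^-monoʳ-≤ (suc n) (m≤m+n d e)))
                                                    (*-monoʳ-≤ b (^-monoʳ-≤ (suc n) (m≤n+m e d))) ⟩
  a * suc n ^ (d + e) + b * suc n ^ (d + e) ≡⟨ *-distribʳ-+ (suc n ^ (d + e)) a b ⟨
  (a + b) * suc n ^ (d + e)             ∎
  where open ≤-Reasoning

*-poly : ∀ {f} → Polynomial f → Polynomial (λ n → n * f n)
*-poly {f} (a , d , f≤) = a , suc d , λ n → begin
  n * f n               ≤⟨ *-mono-≤ (n≤1+n n) (f≤ n) ⟩
  suc n * (a * suc n ^ d) ≡⟨ *-assoc (suc n) a _ ⟨
  suc n * a * suc n ^ d ≡⟨ cong (_* suc n ^ d) (*-comm (suc n) a) ⟩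
  a * suc n * suc n ^ d ≡⟨ *-assoc a (suc n) _ ⟩
  a * suc n ^ suc d     ∎
  where open ≤-Reasoning

bound-poly : ∀ {k} (t : Tm k) → Polynomial (bound t)
bound-poly (exp e)      = const-poly _
bound-poly (bind t u)   =
  const-poly 1 +-poly (bound-poly t +-poly (const-poly 1 +-poly (bound-poly u +-poly const-poly 7)))
bound-poly (cond e t u) =
  const-poly 1 +-poly (const-poly (cost (entry e)) +-poly (bound-poly t +-poly bound-poly u))
bound-poly {k} (loop t u) =
  const-poly 1 +-poly (bound-poly t +-poly (const-poly 1 +-poly (const-poly (suc (cost (cons (hd (drop (suc k))) S₀))) +-poly
  (const-poly 1 +-poly (const-poly 3 +-poly
    *-poly (const-poly 11 +-poly (const-poly 1 +-poly (bound-poly u +-poly const-poly 12)))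
  +-poly const-poly 3)))))

-- Formulas and their evaluation

infixr 7 _∧′_
infixr 6 _∨′_
infixr 5 _⇒_

-- First-order formulas over a graph and two sets of vertices, with k free
-- vertex variables.  In close φ ψ, the formula ψ is read in the sets
-- obtained from the empty ones by replacing them, twice order-many times,
-- by the sets of all v with φ true and with φ false.
data Fm (k : ℕ) : Set where
  _~_ _≈_        : Fin k → Fin k → Fm k
  _∈_            : Fin k → Bool → Fm k
  ¬′_            : Fm k → Fm k
  _∧′_ _∨′_ _⇒_  : Fm k → Fm k → Fm k
  ∃′_ ∀′_        : Fm (suc k) → Fm k
  close          : (Bool → Fm (suc k)) → Fm k → Fm k

-- Not a record type: without η, next is stuck on a variable, which keeps
-- the types of Sat small.
data State (n : ℕ) : Set where
  sets : Vec Bool n → Vec Bool n → State n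

pick : ∀ {n} → Bool → State n → Vec Bool n
pick true  (sets p q) = p
pick false (sets p q) = q

∅ : ∀ {n} → State n
∅ = sets (replicate _ false) (replicate _ false)

iterate : ∀ {A : Set} → (A → A) → ℕ → A → A
iterate f zero    x = x
iterate f (suc m) x = iterate f m (f x)

module Semantics (G : Graph) where

  n = order G
  V = Fin n

  Sat  : ∀ {k} → Fm k → State n → Vec V k → Set
  sat? : ∀ {k} (φ : Fm k) S vs → Dec (Sat φ S vs)
  next : ∀ {k} → (Bool → Fm (suc k)) → Vec V k → State n → State n

  Sat (i ~ j)     S vs = adj G (lookup vs i) (lookup vs j) ≡ true
  Sat (i ≈ j)     S vs = lookup vs i ≡ lookup vs j
  Sat (i ∈ s)     S vs = lookup (pick s S) (lookup vs i) ≡ true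
  Sat (¬′ φ)      S vs = ¬ Sat φ S vs
  Sat (φ ∧′ ψ)    S vs = Sat φ S vs × Sat ψ S vs
  Sat (φ ∨′ ψ)    S vs = Sat φ S vs ⊎ Sat ψ S vs
  Sat (φ ⇒ ψ)     S vs = Sat φ S vs → Sat ψ S vs
  Sat (∃′ φ)      S vs = ∃[ v ] Sat φ S (v ∷ vs)
  Sat (∀′ φ)      S vs = ∀ v → Sat φ S (v ∷ vs)
  Sat (close φ ψ) S vs = Sat ψ (iterate (next φ vs) (n + n) ∅) vs

  sat? (i ~ j)     S vs = adj G (lookup vs i) (lookup vs j) ≟ᵇ true
  sat? (i ≈ j)     S vs = lookup vs i ≟ᶠ lookup vs j
  sat? (i ∈ s)     S vs = lookup (pick s S) (lookup vs i) ≟ᵇ true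
  sat? (¬′ φ)      S vs = ¬? (sat? φ S vs)
  sat? (φ ∧′ ψ)    S vs = sat? φ S vs ×-dec sat? ψ S vs
  sat? (φ ∨′ ψ)    S vs = sat? φ S vs ⊎-dec sat? ψ S vs
  sat? (φ ⇒ ψ)     S vs = sat? φ S vs →-dec sat? ψ S vs
  sat? (∃′ φ)      S vs = any? λ v → sat? φ S (v ∷ vs)
  sat? (∀′ φ)      S vs = all? λ v → sat? φ S (v ∷ vs)
  sat? (close φ ψ) S vs = sat? ψ (iterate (next φ vs) (n + n) ∅) vs

  next φ vs S@(sets _ _) = sets (tabulate λ v → does (sat? (φ true) S (v ∷ vs)))
                                (tabulate λ v → does (sat? (φ false) S (v ∷ vs)))

-- Translation of formulas into loop terms

yes′ : ∀ {k} → Expr k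
yes′ = cons nil nil

-- The accumulator pairs a counter with a list, and every round pops both until the counter is
-- `nil`. As many rounds as there are vertices suffice for a counter that is a vertex number.
dropTm : ∀ {k} → Fin (suc k) → Expr (suc k) → Tm k
dropTm i e = bind
  (loop (exp (cons (var i) e))
        (cond (hd (var 1F)) (exp (cons (tl (hd (var 1F))) (tl (tl (var 1F))))) (exp (var 1F))))
  (exp (tl (var 0F)))

nth : ∀ {k} → Fin (suc k) → Expr (suc k) → Tm k
nth i e = bind (dropTm i e) (exp (hd (var 0F)))

half : ∀ {k} → Bool → Expr k → Expr k
half true  = hd
half false = tl

mutual
  -- σ locates the vertex variables in the environment, and st the pair of
  -- sets; a vertex is given by any list whose length is its number, and a
  -- set by its characteristic list.
  term : ∀ {k m} → (Fin k → Fin (suc m)) → Fin (suc m) → Fm k → Tm m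
  term σ st (i ~ j) = bind (nth (σ i) (var (fromℕ _))) (nth (suc (σ j)) (var 0F))
  -- Two lists have the same length iff dropping the length of either from the other leaves `nil`.
  term σ st (i ≈ j) = bind (dropTm (σ i) (var (σ j))) (cond (var 0F) (exp nil)
                      (bind (dropTm (suc (σ j)) (var (suc (σ i)))) (cond (var 0F) (exp nil) (exp yes′))))
  term σ st (i ∈ s) = nth (σ i) (half s (var st))
  term σ st (¬′ φ)   = bind (term σ st φ) (cond (var 0F) (exp nil) (exp yes′))
  term σ st (φ ∧′ ψ) = bind (term σ st φ) (cond (var 0F) (term (suc ∘ σ) (suc st) ψ) (exp nil))
  term σ st (φ ∨′ ψ) = bind (term σ st φ) (cond (var 0F) (exp yes′) (term (suc ∘ σ) (suc st) ψ))
  term σ st (φ ⇒ ψ)  = bind (term σ st φ) (cond (var 0F) (term (suc ∘ σ) (suc st) ψ) (exp yes′))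
  term σ st (∃′ φ)   = loop (exp nil) (bind (term (under σ) (suc (suc st)) φ) (cond (var 0F) (exp yes′) (exp (var 2F))))
  term σ st (∀′ φ)   = loop (exp yes′) (bind (term (under σ) (suc (suc st)) φ) (cond (var 0F) (exp (var 2F)) (exp nil)))
  term σ st (close φ ψ) =
    -- The inner loop only supplies the initial value of the outer one: two passes in succession,
    -- `n + n` rounds in all.
    bind (loop (loop (exp nil) (nextTm σ φ)) (nextTm σ φ)) (term (suc ∘ σ) 0F ψ)

  under : ∀ {k m} → (Fin k → Fin (suc m)) → Fin (suc k) → Fin (3 + m)
  under σ zero    = 0F
  under σ (suc i) = suc (suc (σ i))

  nextTm : ∀ {k m} → (Fin k → Fin (suc m)) → (Bool → Fm (suc k)) → Tm (2 + m)
  nextTm σ φ = bind (setTm (λ i → suc (suc (σ i))) 1F (φ true))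
              (bind (setTm (λ i → suc (suc (suc (σ i)))) 2F (φ false))
              (exp (cons (var 1F) (var 0F))))

  setTm : ∀ {k m} → (Fin k → Fin (suc m)) → Fin (suc m) → Fm (suc k) → Tm m
  setTm σ st φ = loop (exp nil) (bind (term (under σ) (suc (suc st)) φ) (exp (cons (var 0F) (var 2F))))

-- Correctness of the translation

module Correctness (G : Graph) where

  open Semantics G

  record Encodes {k m} (ρ : Env m) (σ : Fin k → Fin (suc m)) (st : Fin (suc m))
                 (vs : Vec V k) (S : State n) : Set where
    field
      graph  : input ρ ≡ codeGraph G
      vertex : ∀ i → len (lookup ρ (σ i)) ≡ toℕ (lookup vs i)
      state  : ∀ s v → head (tails (toℕ v) (⟦ half s (var st) ⟧ ρ)) ≡ codeBool (lookup (pick s S) v)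

  open Encodes

  shift : ∀ {k m} {ρ : Env m} {σ : Fin k → Fin (suc m)} {st vs S} t →
          Encodes ρ σ st vs S → Encodes (t ∷ ρ) (suc ∘ σ) (suc st) vs S
  shift t E = record { graph = graph E ; vertex = vertex E ; state = λ { true → state E true ; false → state E false } }

  restate : ∀ {k m} {ρ : Env m} {σ : Fin k → Fin (suc m)} {st vs S} st′ {S′} → Encodes ρ σ st vs S →
            (∀ s v → head (tails (toℕ v) (⟦ half s (var st′) ⟧ ρ)) ≡ codeBool (lookup (pick s S′) v)) →
            Encodes ρ σ st′ vs S′
  restate _ E state′ = record { graph = graph E ; vertex = vertex E ; state = state′ }

  enter : ∀ {k m} {ρ : Env m} {σ : Fin k → Fin (suc m)} {st vs S} r acc v → len r ≡ toℕ v →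
          Encodes ρ σ st vs S → Encodes (r ∷ acc ∷ ρ) (under σ) (suc (suc st)) (v ∷ vs) S
  enter r acc v eq E = record
    { graph = graph E ; vertex = λ { zero → eq ; (suc i) → vertex E i }
    ; state = λ { true → state E true ; false → state E false } }

  len-codeList : ∀ {m} (f : Fin m → Tree) → len (codeList (List.tabulate f)) ≡ m
  len-codeList {zero}  f = refl
  len-codeList {suc m} f = cong suc (len-codeList (f ∘ suc))

  nth-codeList : ∀ {m} (f : Fin m → Tree) v → head (tails (toℕ v) (codeList (List.tabulate f))) ≡ f v
  nth-codeList f zero    = refl
  nth-codeList f (suc v) = nth-codeList (f ∘ suc) v

  len-input : ∀ {m} (ρ : Env m) → input ρ ≡ codeGraph G → len (input ρ) ≡ n
  len-input ρ eq = trans (cong len eq) (len-codeList _)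

  private
    dropStep : Tree → Tree → Tree
    dropStep r acc = choose (head acc) (tail (head acc) ∙ tail (tail acc)) acc

  dropStep-nil : ∀ N xs → foldTails dropStep N (nil ∙ xs) ≡ nil ∙ xs
  dropStep-nil nil     xs = refl
  dropStep-nil (_ ∙ r) xs = dropStep-nil r xs

  dropStep-correct : ∀ N i xs → len i ≤ len N → foldTails dropStep N (i ∙ xs) ≡ nil ∙ tails (len i) xs
  dropStep-correct N       nil     xs i≤N       = dropStep-nil N xs
  dropStep-correct (_ ∙ r) (_ ∙ i) xs (s≤s i≤r) = dropStep-correct r i (tail xs) i≤r

  dropTm-correct : ∀ {m} (ρ : Env m) i e (v : V) → input ρ ≡ codeGraph G → len (lookup ρ i) ≡ toℕ v →
                   ev (dropTm i e) ρ ≡ tails (toℕ v) (⟦ e ⟧ ρ)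
  dropTm-correct ρ i e v graph eq = trans
    (cong tail (dropStep-correct (input ρ) (lookup ρ i) (⟦ e ⟧ ρ) (subst₂ _≤_ (sym eq) (sym (len-input ρ graph)) (<⇒≤ (toℕ<n v)))))
    (cong (λ l → tails l (⟦ e ⟧ ρ)) eq)

  nth-correct : ∀ {m} (ρ : Env m) i e (v : V) → input ρ ≡ codeGraph G → len (lookup ρ i) ≡ toℕ v →
                ev (nth i e) ρ ≡ head (tails (toℕ v) (⟦ e ⟧ ρ))
  nth-correct ρ i e v graph eq = cong head (dropTm-correct ρ i e v graph eq)

  -- Numbers count down: `I m` describes an accumulator that accounts for the vertices numbered `m`
  -- and above.
  foldTails-invariant : (I : ℕ → Tree → Set) (f : Tree → Tree → Tree) →
    (∀ r acc (v : V) → len r ≡ toℕ v → I (suc (toℕ v)) acc → I (toℕ v) (f r acc)) →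
    ∀ N acc → len N ≤ n → I (len N) acc → I 0 (foldTails f N acc)
  foldTails-invariant I f pres nil     acc N≤n init = init
  foldTails-invariant I f pres (_ ∙ r) acc N≤n init =
    foldTails-invariant I f pres r (f r acc) (<⇒≤ N≤n)
      (subst (λ l → I l (f r acc)) v≡
        (pres r acc v (sym v≡) (subst (λ l → I (suc l) acc) (sym v≡) init)))
    where
    v  = fromℕ< N≤n
    v≡ = toℕ-fromℕ< N≤n

  does-⇔ : ∀ {A B : Set} (a? : Dec A) (b? : Dec B) → (A → B) → (B → A) → does a? ≡ does b?
  does-⇔ (yes a) b? f g = sym (dec-true b? (f a))
  does-⇔ (no ¬a) b? f g = sym (dec-false b? (¬a ∘ g))

  Decides : Set → Tree → Set
  Decides A t = Σ (Dec A) λ a? → t ≡ codeBool (does a?)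

  ≤-cases : ∀ (u v : V) → toℕ u ≤ toℕ v → u ≡ v ⊎ suc (toℕ u) ≤ toℕ v
  ≤-cases u v u≤v with m≤n⇒m<n∨m≡n u≤v
  ... | inj₁ u<v = inj₂ u<v
  ... | inj₂ u≡v = inj₁ (toℕ-injective u≡v)

  module _ {P : V → Set} (P? : ∀ v → Dec (P v)) {F : Tree → Tree → Tree}
           (F-correct : ∀ r acc v → len r ≡ toℕ v → F r acc ≡ codeBool (does (P? v)))
           (N : Tree) (lenN : len N ≡ n) where

    any-loop : foldTails (λ r acc → choose (F r acc) (codeBool true) acc) N nil ≡ codeBool (does (any? P?))
    any-loop with foldTails-invariant (λ m → Decides (∃ λ v → m ≤ toℕ v × P v)) _ pres N nil (≤-reflexive lenN)
                    (no (λ (v , N≤v , _) → <⇒≱ (subst (toℕ v <_) (sym lenN) (toℕ<n v)) N≤v) , refl)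
      where
      pres : ∀ r acc v → len r ≡ toℕ v → Decides (∃ λ w → suc (toℕ v) ≤ toℕ w × P w) acc →
             Decides (∃ λ w → toℕ v ≤ toℕ w × P w) (choose (F r acc) (codeBool true) acc)
      pres r acc v eq (d , acc≡) rewrite F-correct r acc v eq with P? v
      ... | yes p = yes (v , ≤-refl , p) , refl
      ... | no ¬p = map′ (λ (w , v<w , q) → w , <⇒≤ v<w , q) back d , acc≡
        where
        back : (∃ λ w → toℕ v ≤ toℕ w × P w) → ∃ λ w → suc (toℕ v) ≤ toℕ w × P w
        back (w , v≤w , q) with ≤-cases v w v≤w
        ... | inj₁ refl = contradiction q ¬p
        ... | inj₂ v<w  = w , v<w , q
    ... | d , eq = trans eq (cong codeBool (does-⇔ d (any? P?) (λ (v , _ , p) → v , p) (λ (v , p) → v , z≤n , p)))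

    all-loop : foldTails (λ r acc → choose (F r acc) acc nil) N (codeBool true) ≡ codeBool (does (all? P?))
    all-loop with foldTails-invariant (λ m → Decides (∀ v → m ≤ toℕ v → P v)) _ pres N (codeBool true) (≤-reflexive lenN)
                    (yes (λ v N≤v → contradiction N≤v (<⇒≱ (subst (toℕ v <_) (sym lenN) (toℕ<n v)))) , refl)
      where
      pres : ∀ r acc v → len r ≡ toℕ v → Decides (∀ w → suc (toℕ v) ≤ toℕ w → P w) acc →
             Decides (∀ w → toℕ v ≤ toℕ w → P w) (choose (F r acc) acc nil)
      pres r acc v eq (d , acc≡) rewrite F-correct r acc v eq with P? v
      ... | no ¬p = no (λ q → ¬p (q v ≤-refl)) , refl
      ... | yes p = map′ extend (λ q w v<w → q w (<⇒≤ v<w)) d , acc≡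
        where
        extend : (∀ w → suc (toℕ v) ≤ toℕ w → P w) → ∀ w → toℕ v ≤ toℕ w → P w
        extend q w v≤w with ≤-cases v w v≤w
        ... | inj₁ refl = p
        ... | inj₂ v<w  = q w v<w
    ... | d , eq = trans eq (cong codeBool (does-⇔ d (all? P?) (λ p v → p v z≤n) (λ p v _ → p v)))

    set-loop : ∀ v → head (tails (toℕ v) (foldTails (λ r acc → F r acc ∙ acc) N nil)) ≡ codeBool (does (P? v))
    set-loop v = foldTails-invariant
      -- The accumulator is the characteristic list from vertex `m` on, so vertex `w` stands at
      -- position `toℕ w ∸ m`.
      (λ m acc → ∀ w → m ≤ toℕ w → head (tails (toℕ w ∸ m) acc) ≡ codeBool (does (P? w))) _ pres N nil (≤-reflexive lenN)
      (λ w N≤w → contradiction N≤w (<⇒≱ (subst (toℕ w <_) (sym lenN) (toℕ<n w)))) v z≤n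
      where
      pres : ∀ r acc v → len r ≡ toℕ v →
             (∀ w → suc (toℕ v) ≤ toℕ w → head (tails (toℕ w ∸ suc (toℕ v)) acc) ≡ codeBool (does (P? w))) →
             ∀ w → toℕ v ≤ toℕ w → head (tails (toℕ w ∸ toℕ v) (F r acc ∙ acc)) ≡ codeBool (does (P? w))
      pres r acc v eq IH w v≤w with ≤-cases v w v≤w
      ... | inj₁ refl rewrite n∸n≡0 (toℕ v) = F-correct r acc v eq
      ... | inj₂ v<w rewrite +-∸-assoc 1 v<w = IH w v<w

  tails-nil : ∀ i → tails i nil ≡ nil
  tails-nil zero    = refl
  tails-nil (suc i) = tails-nil i

  equal-correct : ∀ s t → choose (tails (len s) t) nil (choose (tails (len t) s) nil (codeBool true)) ≡
                          codeBool (does (len s ≟ len t))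
  equal-correct nil     nil     = refl
  equal-correct nil     (_ ∙ t) = refl
  equal-correct (_ ∙ s) nil     rewrite tails-nil (len s) = refl
  equal-correct (_ ∙ s) (_ ∙ t) = equal-correct s t

  -- `nil` can code the pair of empty sets for every number of vertices, since all its heads and
  -- tails are `nil`, the code of `false`.
  nil-state : ∀ s i (v : V) → head (tails i (⟦ half s (var 0F) ⟧ (nil ∷ []))) ≡ codeBool (lookup (pick s ∅) v)
  nil-state s i v = trans (cong head (lemma s i)) (cong codeBool (sym (empty s v)))
    where
    lemma : ∀ s i → tails i (⟦ half s (var 0F) ⟧ (nil ∷ [])) ≡ nil
    lemma true  = tails-nil
    lemma false = tails-nil
    empty : ∀ s (v : V) → lookup (pick s ∅) v ≡ false
    empty true  v = lookup-replicate v false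
    empty false v = lookup-replicate v false

  Represents : Tree → State n → Set
  Represents t S = ∀ s v → head (tails (toℕ v) (⟦ half s (var 0F) ⟧ (t ∷ []))) ≡ codeBool (lookup (pick s S) v)

  to-state : ∀ {k m} {ρ : Env m} {σ : Fin k → Fin (suc m)} {st vs S} st′ {S′} → Represents (lookup ρ st′) S′ →
             Encodes ρ σ st vs S → Encodes ρ σ st′ vs S′
  to-state _ R E = restate _ E λ { true → R true ; false → R false }

  iterate-+ : ∀ {A : Set} (f : A → A) i j x → iterate f j (iterate f i x) ≡ iterate f (i + j) x
  iterate-+ f zero    j x = refl
  iterate-+ f (suc i) j x = iterate-+ f i j (f x)

  mutual
    term-correct : ∀ {k m} {ρ : Env m} {σ : Fin k → Fin (suc m)} {st vs S} (φ : Fm k) → Encodes ρ σ st vs S →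
                   ev (term σ st φ) ρ ≡ codeBool (does (sat? φ S vs))
    term-correct {ρ = ρ} {σ} {st} {vs} (i ~ j) E = trans
      (nth-correct (_ ∷ ρ) (suc (σ j)) (var 0F) (lookup vs j) (graph E) (vertex E j))
      (trans (cong (head ∘ tails (toℕ (lookup vs j))) (trans
        (nth-correct ρ (σ i) (var (fromℕ _)) (lookup vs i) (graph E) (vertex E i))
        (trans (cong (head ∘ tails (toℕ (lookup vs i))) (graph E))
               (nth-codeList (λ u → codeList (List.tabulate λ v → codeBool (adj G u v))) (lookup vs i)))))
      (trans (nth-codeList (λ v → codeBool (adj G (lookup vs i) v)) (lookup vs j)) (cong codeBool (lemma _))))
      where
      lemma : ∀ b → b ≡ does (b ≟ᵇ true)
      lemma true  = refl
      lemma false = refl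
    term-correct {ρ = ρ} {σ} {st} {vs} (i ≈ j) E
      rewrite dropTm-correct ρ (σ i) (var (σ j)) (lookup vs i) (graph E) (vertex E i)
            | dropTm-correct (tails (toℕ (lookup vs i)) (lookup ρ (σ j)) ∷ ρ)
                (suc (σ j)) (var (suc (σ i))) (lookup vs j) (graph E) (vertex E j)
            | sym (vertex E i) | sym (vertex E j) =
      trans (equal-correct (lookup ρ (σ i)) (lookup ρ (σ j)))
            (cong codeBool (does-⇔ (len (lookup ρ (σ i)) ≟ len (lookup ρ (σ j))) (lookup vs i ≟ᶠ lookup vs j)
              (λ eq → toℕ-injective (trans (sym (vertex E i)) (trans eq (vertex E j))))
              (λ eq → trans (vertex E i) (trans (cong toℕ eq) (sym (vertex E j))))))
    term-correct {ρ = ρ} {σ} {st} {vs} {S} (i ∈ s) E = trans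
      (nth-correct ρ (σ i) (half s (var st)) (lookup vs i) (graph E) (vertex E i))
      (trans (state E s (lookup vs i)) (cong codeBool (lemma (lookup (pick s S) (lookup vs i)))))
      where
      lemma : ∀ b → b ≡ does (b ≟ᵇ true)
      lemma true  = refl
      lemma false = refl
    term-correct {vs = vs} {S} (¬′ φ) E rewrite term-correct φ E with does (sat? φ S vs)
    ... | true  = refl
    ... | false = refl
    term-correct {vs = vs} {S} (φ ∧′ ψ) E rewrite term-correct φ E with does (sat? φ S vs)
    ... | true  = term-correct ψ (shift _ E)
    ... | false = refl
    term-correct {vs = vs} {S} (φ ∨′ ψ) E rewrite term-correct φ E with does (sat? φ S vs)
    ... | true  = refl
    ... | false = term-correct ψ (shift _ E)
    term-correct {vs = vs} {S} (φ ⇒ ψ) E rewrite term-correct φ E with does (sat? φ S vs)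
    ... | true  = term-correct ψ (shift _ E)
    ... | false = refl
    term-correct {ρ = ρ} {vs = vs} {S} (∃′ φ) E =
      any-loop (λ v → sat? φ S (v ∷ vs)) (λ r acc v eq → term-correct φ (enter r acc v eq E)) _ (len-input ρ (graph E))
    term-correct {ρ = ρ} {vs = vs} {S} (∀′ φ) E =
      all-loop (λ v → sat? φ S (v ∷ vs)) (λ r acc v eq → term-correct φ (enter r acc v eq E)) _ (len-input ρ (graph E))
    term-correct {ρ = ρ} {σ} {vs = vs} (close φ ψ) E =
      term-correct ψ (to-state 0F (subst (Represents _) (iterate-+ (next φ vs) n n ∅) twice) (shift _ E))
      where
      once : ∀ {t S} → Represents t S →
             Represents (foldTails (λ r acc → ev (nextTm σ φ) (r ∷ acc ∷ ρ)) (input ρ) t) (iterate (next φ vs) n S)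
      once {t} {S} R = subst (λ l → Represents _ (iterate (next φ vs) l S)) (len-input ρ (graph E))
                             (rounds φ E (input ρ) t S R)
      twice = once (once λ s v → nil-state s (toℕ v) v)

    rounds : ∀ {k m} {ρ : Env m} {σ : Fin k → Fin (suc m)} {st vs S} (φ : Bool → Fm (suc k)) → Encodes ρ σ st vs S →
             ∀ N t S′ → Represents t S′ →
             Represents (foldTails (λ r acc → ev (nextTm σ φ) (r ∷ acc ∷ ρ)) N t) (iterate (next φ vs) (len N) S′)
    rounds φ E nil     t S′ R = R
    rounds φ E (_ ∙ r) t (sets _ _) R = rounds φ E r _ _ λ
      { true  v → trans (setTm-correct (φ true) E₁ v) (cong codeBool (sym (lookup∘tabulate _ v)))
      ; false v → trans (setTm-correct (φ false) E₂ v) (cong codeBool (sym (lookup∘tabulate _ v))) }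
      where
      E₁ = to-state 1F R (shift r (shift t E))
      E₂ = to-state 2F R (shift _ (shift r (shift t E)))

    setTm-correct : ∀ {k m} {ρ : Env m} {σ : Fin k → Fin (suc m)} {st vs S} (φ : Fm (suc k)) → Encodes ρ σ st vs S →
                    ∀ v → head (tails (toℕ v) (ev (setTm σ st φ) ρ)) ≡ codeBool (does (sat? φ S (v ∷ vs)))
    setTm-correct {ρ = ρ} {vs = vs} {S} φ E =
      set-loop (λ v → sat? φ S (v ∷ vs)) (λ r acc v eq → term-correct φ (enter r acc v eq E)) _ (len-input ρ (graph E))

-- Definable problems are polynomial

evaluator : Fm 0 → Tm 0
evaluator φ = bind (exp nil) (term (λ ()) 0F φ)

evaluator-correct : ∀ G φ → let open Semantics G in
                    ev (evaluator φ) (codeGraph G ∷ []) ≡ codeBool (does (sat? φ ∅ []))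
evaluator-correct G φ = term-correct φ record
  { graph = refl ; vertex = λ () ; state = λ { true v → nil-state true (toℕ v) v ; false v → nil-state false (toℕ v) v } }
  where
  open Correctness G

len<size : ∀ t → suc (len t) ≤ size t
len<size nil     = ≤-refl
len<size (s ∙ t) = s≤s (≤-trans (len<size t) (m≤n+m (size t) (size s)))

definable⇒polynomial : (φ : Fm 0) (P : Graph → Set) (Q : Graph → Set) →
  (∀ G → P G → Q G ⇔ Semantics.Sat G φ ∅ []) →
  PolynomialTime (record { Instance = Graph ; code = codeGraph ; Yes = Q } ↾ P)
definable⇒polynomial φ P Q equiv =
  program , a , d , λ (G , pG) →
    let open Semantics G
        run {time} p p≤ = whole (codeGraph G)
        open ≤-Reasoning
    in does (sat? φ ∅ []) ,
       (_ , _ , p , evaluator-correct G φ , (begin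
         time                                   ≤⟨ p≤ ⟩
         total (len (codeGraph G))              ≤⟨ total≤ _ ⟩
         a * suc (len (codeGraph G)) ^ d        ≤⟨ *-monoʳ-≤ a (^-monoˡ-≤ d (len<size (codeGraph G))) ⟩
         a * size (codeGraph G) ^ d             ∎)) ,
       proof (map (record { to = Equivalence.from (equiv G pG) ; from = Equivalence.to (equiv G pG)
                          ; to-cong = λ { refl → refl } ; from-cong = λ { refl → refl } }) (sat? φ ∅ []))
  where
  t = evaluator φ
  program : Program
  program = record { auxiliaries = 0 ; body = zero ≔ cons S₀ nil ⨾ compile t ⨾ zero ≔ hd S₀ }
  total : ℕ → ℕ
  total n = suc (4 + suc (bound t n + 3))
  whole : ∀ M → Run (Program.body program) M (ev t (M ∷ [])) (total (len M))
  whole M = assign refl ▹ correct t (M ∷ []) ▹ assign refl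
  total-poly : Polynomial total
  total-poly = const-poly 5 +-poly (const-poly 1 +-poly (bound-poly t +-poly const-poly 3))
  a = proj₁ total-poly
  d = proj₁ (proj₂ total-poly)
  total≤ = proj₂ (proj₂ total-poly)

-- The forcing rules

data Opposite : Bool → Bool → Set where
  tf : Opposite true false
  ft : Opposite false true

opp : ∀ {s o} → Opposite s o → Opposite o s
opp tf = ft
opp ft = tf

between : ∀ {k} → (d c e : Fin k) → Fm k
between d c e = d ~ c ∧′ d ~ e ∧′ (∀′ (suc d ~ 0F ⇒ 0F ≈ suc c ∨′ 0F ≈ suc e))

-- In a perfect matching cut, c and e are then on different sides, and d and
-- f are their partners, in either order.
lock : ∀ {k} → (c e d f : Fin k) → Fm k
lock c e d f = ¬′ (d ≈ f) ∧′ ¬′ (c ≈ e) ∧′ between d c e ∧′ between f c e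

-- If `c` lies on side `s`, its partner does not, so `w` is adjacent to that partner. The partner
-- has no neighbour on side `s` except `c`; hence `w`, if different from `c`, lies on the other
-- side.
dominates : ∀ {k} → Bool → (c w : Fin k) → Fm k
dominates s c w = ∀′ (suc c ~ 0F ⇒ 0F ∈ s ∨′ suc w ~ 0F)

-- Conditions that force v, the first free variable, onto side s, where o is
-- the other side.
module _ {k : ℕ} (s o : Bool) where
  matchedNbr twoNbrs triangle lastNbr leaf crossed pair lockEnd lockNbr : Fm (suc k)
  matchedNbr = ∃′ ∃′ (1F ∈ s ∧′ 2F ~ 1F ∧′ 0F ∈ o ∧′ 1F ~ 0F ∧′ ¬′ (0F ≈ 2F))
  twoNbrs    = ∃′ ∃′ (1F ∈ s ∧′ 0F ∈ s ∧′ ¬′ (1F ≈ 0F) ∧′ 2F ~ 1F ∧′ 2F ~ 0F)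
  triangle   = ∃′ ∃′ (1F ∈ s ∧′ 2F ~ 1F ∧′ 2F ~ 0F ∧′ 1F ~ 0F)
  lastNbr    = ∃′ (0F ∈ o ∧′ 1F ~ 0F ∧′ (∀′ (1F ~ 0F ⇒ 0F ∈ o ∨′ 0F ≈ 2F)))
  leaf       = ∃′ (0F ∈ o ∧′ 1F ~ 0F ∧′ (∀′ (2F ~ 0F ⇒ 0F ≈ 1F)))
  -- v = 4, c = 3, p = 2, d = 1, f = 0
  crossed    = ∃′ ∃′ ∃′ ∃′ (3F ∈ s ∧′ 2F ∈ s ∧′ 4F ~ 3F ∧′ 4F ~ 1F ∧′ 4F ~ 0F ∧′ 2F ~ 1F ∧′ 2F ~ 0F
                 ∧′ ¬′ (1F ≈ 0F) ∧′ ¬′ (1F ≈ 3F) ∧′ ¬′ (0F ≈ 3F))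
  -- v = 3, c = 2, w₁ = 1, w₂ = 0
  pair       = ∃′ ∃′ ∃′ (2F ∈ o ∧′ 3F ~ 2F ∧′ 3F ~ 1F ∧′ 3F ~ 0F ∧′ ¬′ (1F ≈ 0F) ∧′ ¬′ (1F ≈ 2F) ∧′ ¬′ (0F ≈ 2F)
                 ∧′ (1F ∈ s ∨′ dominates o 2F 1F) ∧′ dominates o 2F 0F)
  -- c = 2, e = v = 3, d = 1, f = 0
  lockEnd    = ∃′ ∃′ ∃′ (2F ∈ o ∧′ lock 2F 3F 1F 0F)
  -- v = 4, c = 3, e = 2, d = 1, f = 0
  lockNbr    = ∃′ ∃′ ∃′ ∃′ (3F ∈ s ∧′ 4F ~ 3F ∧′ lock 3F 2F 1F 0F ∧′ ¬′ (4F ≈ 1F) ∧′ ¬′ (4F ≈ 0F))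

  rule : Fm (suc k)
  rule = matchedNbr ∨′ twoNbrs ∨′ triangle ∨′ lastNbr ∨′ leaf ∨′ crossed ∨′ pair ∨′ lockEnd ∨′ lockNbr

module Notation (G : Graph) where
  open Semantics G public

  infix 4 _─_
  _─_ : V → V → Set
  u ─ v = adj G u v ≡ true

  _─?_ : ∀ u v → Dec (u ─ v)
  u ─? v = adj G u v ≟ᵇ true

  ─-sym : ∀ {u v} → u ─ v → v ─ u
  ─-sym {u} {v} p = trans (Graph.symmetric G v u) p

  ─⇒≢ : ∀ {u v} → u ─ v → u ≢ v
  ─⇒≢ {u} p refl with trans (sym p) (irreflexive G u)
  ... | ()

  Between : V → V → V → Set
  Between d c e = d ─ c × d ─ e × (∀ w → d ─ w → w ≡ c ⊎ w ≡ e)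

  Lock : V → V → V → V → Set
  Lock c e d f = d ≢ f × c ≢ e × Between d c e × Between f c e

  Locked : V → Set
  Locked c = ∃ λ e → ∃ λ d → ∃ λ f → Lock c e d f

  lock-sym : ∀ {c e d f} → Lock c e d f → Lock e c d f
  lock-sym (d≢f , c≢e , (dc , de , d!) , (fc , fe , f!)) =
    d≢f , c≢e ∘ sym , (de , dc , λ w → swap ∘ d! w) , (fe , fc , λ w → swap ∘ f! w)

  module InState (S : State n) where
    In : Bool → V → Set
    In s v = lookup (pick s S) v ≡ true

    In? : ∀ s v → Dec (In s v)
    In? s v = lookup (pick s S) v ≟ᵇ true

    Matched : Bool → V → Set
    Matched o c = ∃[ w ] In o w × c ─ w

    Matched? : ∀ o c → Dec (Matched o c)
    Matched? o c = any? λ w → In? o w ×-dec (c ─? w)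

    Free : V → Set
    Free v = ∀ s → ¬ In s v

    Dominates : Bool → V → V → Set
    Dominates s c w = ∀ u → c ─ u → In s u ⊎ w ─ u

    -- The history of the colouring, which the sets alone forget: whichever rule colours `v`, it
    -- does so through a coloured neighbour or a lock.
    data Rooted (s o : Bool) (v : V) : Set where
      byMatch : ∀ {w} → In o w → v ─ w → Rooted s o v
      byLock  : Locked v → Rooted s o v
      byNbr   : ∀ {u} → In s u → v ─ u → Rooted s o u → Rooted s o v

    free : ∀ {s o v} → Opposite s o → ¬ In s v → ¬ In o v → Free v
    free tf p q true  = p
    free tf p q false = q
    free ft p q true  = q
    free ft p q false = p

    side : ∀ {s o} → Opposite s o → ∀ v → In s v ⊎ In o v ⊎ Free v
    side {s} {o} op v with In? s v | In? o v
    ... | yes p | _     = inj₁ p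
    ... | no p  | yes q = inj₂ (inj₁ q)
    ... | no p  | no q  = inj₂ (inj₂ (free op p q))

noT : ∀ {G} → (T -Free) G → let open Notation G in ∀ {a b c d e f} →
      a ─ b → b ─ c → c ─ d → d ─ e → c ─ f →
      ¬ a ─ c → ¬ a ─ d → ¬ a ─ e → ¬ a ─ f → ¬ b ─ d → ¬ b ─ e → ¬ b ─ f →
      ¬ c ─ e → ¬ d ─ f → ¬ e ─ f → ⊥
noT {G} tfree {a} {b} {c} {d} {e} {f} ab bc cd de cf ac ad ae af bd be bf ce df ef =
  tfree record { embed = embed ; injective = injective _ _ ; preserves = preserves }
  where
  open Notation G
  embed : Fin 6 → V
  embed = lookup (a ∷ b ∷ c ∷ d ∷ e ∷ f ∷ [])
  non : ∀ {u v} → ¬ u ─ v → adj G u v ≡ false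
  non = ¬-not
  non′ : ∀ {u v} → ¬ u ─ v → adj G v u ≡ false
  non′ {u} {v} p = trans (Graph.symmetric G v u) (non p)
  loopless : ∀ v → adj G v v ≡ false
  loopless = irreflexive G
  preserves : ∀ u v → adj G (embed u) (embed v) ≡ adj T u v
  preserves 0F 0F = loopless a
  preserves 0F 1F = ab
  preserves 0F 2F = non ac
  preserves 0F 3F = non ad
  preserves 0F 4F = non ae
  preserves 0F 5F = non af
  preserves 1F 0F = ─-sym ab
  preserves 1F 1F = loopless b
  preserves 1F 2F = bc
  preserves 1F 3F = non bd
  preserves 1F 4F = non be
  preserves 1F 5F = non bf
  preserves 2F 0F = non′ ac
  preserves 2F 1F = ─-sym bc
  preserves 2F 2F = loopless c
  preserves 2F 3F = cd
  preserves 2F 4F = non ce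
  preserves 2F 5F = cf
  preserves 3F 0F = non′ ad
  preserves 3F 1F = non′ bd
  preserves 3F 2F = ─-sym cd
  preserves 3F 3F = loopless d
  preserves 3F 4F = de
  preserves 3F 5F = non df
  preserves 4F 0F = non′ ae
  preserves 4F 1F = non′ be
  preserves 4F 2F = non′ ce
  preserves 4F 3F = ─-sym de
  preserves 4F 4F = loopless e
  preserves 4F 5F = non ef
  preserves 5F 0F = non′ af
  preserves 5F 1F = non′ bf
  preserves 5F 2F = ─-sym cf
  preserves 5F 3F = non′ df
  preserves 5F 4F = non′ ef
  preserves 5F 5F = loopless f
  distinct : ∀ u v → (∀ w → adj T u w ≡ adj T v w) → u ≡ v
  distinct = from-yes (all? λ u → all? λ v → all? (λ w → adj T u w ≟ᵇ adj T v w) →-dec u ≟ᶠ v)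
  injective : ∀ u v → embed u ≡ embed v → u ≡ v
  injective u v eq = distinct u v λ w →
    trans (sym (preserves u w)) (trans (cong (λ x → adj G x (embed w)) eq) (preserves v w))

-- Closed states of T-free graphs

module Closed (G : Graph) (tfree : (T -Free) G) (S : State (order G)) {k} (vs : Vec (Fin (order G)) k) where
  open Notation G
  open InState S

  record IsClosed : Set where
    field
      closed   : ∀ {s o} → Opposite s o → ∀ {v} → Sat (rule s o) S (v ∷ vs) → In s v
      disjoint : ∀ {s o v} → Opposite s o → In s v → ¬ In o v
      rooted   : ∀ {s o v} → Opposite s o → In s v → Rooted s o v
      exits    : ∀ {s o c} → Opposite s o → In s c → ∃[ w ] c ─ w × ¬ In s w

  module Facts (isClosed : IsClosed) where
    open IsClosed isClosed

    -- `r` is meant as the end of the long path of an induced `T` that continues through `q`; the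
    -- clauses about `r` provide its non-adjacencies. The last clause settles uncoloured paths that
    -- start at `q` itself.
    Anchored : Bool → Bool → V → Set
    Anchored s o q = In s q × ∃[ r ] q ─ r ×
      (∀ {y} → In s y → ¬ Matched o y → y ≢ q → ¬ r ─ y) ×
      (∀ {y} → Free y → ¬ r ─ y) ×
      (∀ {x y} → Free x → Free y → q ─ x → ¬ x ─ y)

    matched-nbr : ∀ {s o} → Opposite s o → ∀ {u v} → In s u → Matched o u → Free v → ¬ u ─ v
    matched-nbr {s} {o} op {u} {v} u∈s (w , w∈o , uw) v-free uv =
      v-free s (closed op (inj₁ (u , w , u∈s , ─-sym uv , w∈o , uw , λ { refl → v-free o w∈o })))

    nbr-unique : ∀ {s o} → Opposite s o → ∀ {v u w} → Free v → In s u → In s w → v ─ u → v ─ w → u ≡ w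
    nbr-unique {s} op {v} {u} {w} v-free u∈s w∈s vu vw with u ≟ᶠ w
    ... | yes eq = eq
    ... | no u≢w = ⊥-elim (v-free s (closed op (inj₂ (inj₁ (u , w , u∈s , w∈s , u≢w , vu , vw)))))

    no-triangle : ∀ {s o} → Opposite s o → ∀ {c d e} → In s c → Free d → c ─ d → d ─ e → ¬ c ─ e
    no-triangle {s} op c∈s d-free cd de ce =
      d-free s (closed op (inj₂ (inj₂ (inj₁ (_ , _ , c∈s , ─-sym cd , de , ce)))))

    unmatched : ∀ {s o} → Opposite s o → ∀ {c d} → In s c → Free d → c ─ d → ¬ Matched o c
    unmatched op c∈s d-free cd m = matched-nbr op c∈s m d-free cd

    -- If the exit `d` were the only neighbour outside `s`, then `lastNbr` would colour it `o` and
    -- `c` would be matched.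
    two-free : ∀ {s o} → Opposite s o → ∀ {c} → In s c → ¬ Matched o c →
               ∃[ d ] ∃[ f ] d ≢ f × Free d × Free f × c ─ d × c ─ f
    two-free {s} {o} op {c} c∈s um with exits op c∈s
    ... | d , cd , d∉s with any? (λ f → ¬? (d ≟ᶠ f) ×-dec (¬? (In? s f) ×-dec (c ─? f)))
    ...   | yes (f , d≢f , f∉s , cf) =
            d , f , d≢f , free op d∉s (λ d∈o → um (d , d∈o , cd)) , free op f∉s (λ f∈o → um (f , f∈o , cf)) , cd , cf
    ...   | no none = ⊥-elim (um (d , closed (opp op) (inj₂ (inj₂ (inj₂ (inj₁
              (c , c∈s , ─-sym cd , only))))) , cd))
      where
      only : ∀ w → c ─ w → In s w ⊎ w ≡ d
      only w cw with In? s w | d ≟ᶠ w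
      ... | yes p | _      = inj₁ p
      ... | no p  | yes eq = inj₂ (sym eq)
      ... | no p  | no d≢w = ⊥-elim (none (w , d≢w , p , cw))

    anchored-match : ∀ {s o} → Opposite s o → ∀ {q} → In s q → Matched o q → Anchored s o q
    anchored-match op {q} q∈s (r , r∈o , qr) = q∈s , r , qr ,
      (λ y∈s um y≢q ry → um (r , r∈o , ─-sym ry)) ,
      (λ y-free → matched-nbr (opp op) r∈o (q , q∈s , ─-sym qr) y-free) ,
      (λ x-free _ qx _ → matched-nbr op q∈s (r , r∈o , qr) x-free qx)

    lock-end : ∀ {s o} → Opposite s o → ∀ {c e d f} → In s c → Lock c e d f → In o e
    lock-end op {c} {e} {d} {f} c∈s l =
      closed (opp op) (inj₂ (inj₂ (inj₂ (inj₂ (inj₂ (inj₂ (inj₂ (inj₁ (c , d , f , c∈s , l)))))))))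

    -- Here `r` is the vertex `d` of the lock, whose neighbours `q` and `e` are both coloured. A
    -- free neighbour of `q` other than `d` and `f` would be coloured by `lockNbr`.
    anchored-lock : ∀ {s o} → Opposite s o → ∀ {q} → In s q → Locked q → Anchored s o q
    anchored-lock {s} {o} op {q} q∈s (e , d , f , l@(d≢f , q≢e , (dq , de , d!) , (fq , fe , f!))) =
      q∈s , d , ─-sym dq , other , (λ y-free dy → ends-not-free y-free (d! _ dy)) , isolated
      where
      e∈o = lock-end op q∈s l
      other : ∀ {y} → In s y → ¬ Matched o y → y ≢ q → ¬ d ─ y
      other y∈s _ y≢q dy with d! _ dy
      ... | inj₁ y≡q  = y≢q y≡q
      ... | inj₂ refl = disjoint op y∈s e∈o
      ends-not-free : ∀ {y} → Free y → ¬ (y ≡ q ⊎ y ≡ e)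
      ends-not-free y-free (inj₁ refl) = y-free s q∈s
      ends-not-free y-free (inj₂ refl) = y-free o e∈o
      isolated : ∀ {x y} → Free x → Free y → q ─ x → ¬ x ─ y
      isolated {x} {y} x-free y-free qx xy with x ≟ᶠ d | x ≟ᶠ f
      ... | yes refl | _        = ends-not-free y-free (d! _ xy)
      ... | no _     | yes refl = ends-not-free y-free (f! _ xy)
      ... | no x≢d   | no x≢f   = x-free s (closed op (inj₂ (inj₂ (inj₂ (inj₂ (inj₂ (inj₂ (inj₂ (inj₂
              (q , e , d , f , q∈s , ─-sym qx , l , x≢d , x≢f))))))))))

    Near : Bool → Bool → V → Set
    Near s o c = ∃[ q ] Anchored s o q × q ─ c

    -- Induction along the chain of reasons. In the critical case `c` is two steps away from the
    -- anchored `q`, with `p` in between and both `c` and `p` unmatched. Then `T`-freeness joins a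
    -- free neighbour `x` of `c` to two free neighbours of `p`, and `crossed` colours `x`.
    anchored-or-near : ∀ {s o} → Opposite s o → ∀ {c} → In s c → Rooted s o c → Anchored s o c ⊎ Near s o c
    anchored-or-near op c∈s (byMatch w∈o cw) = inj₁ (anchored-match op c∈s (_ , w∈o , cw))
    anchored-or-near op c∈s (byLock l)       = inj₁ (anchored-lock op c∈s l)
    anchored-or-near {s} {o} op {c} c∈s (byNbr {p} p∈s cp root) with anchored-or-near op p∈s root
    ... | inj₁ anch = inj₂ (p , anch , ─-sym cp)
    ... | inj₂ (q , anch@(q∈s , r , qr , r-in , r-free , q-free) , qp)
      with Matched? o c | Matched? o p | q ≟ᶠ c | q ─? c
    ...   | yes m | _     | _        | _      = inj₁ (anchored-match op c∈s m)
    ...   | no _  | yes m | _        | _      = inj₂ (p , anchored-match op p∈s m , ─-sym cp)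
    ...   | no _  | no _  | yes refl | _      = inj₁ anch
    ...   | no _  | no _  | no _     | yes qc = inj₂ (q , anch , qc)
    ...   | no mc | no mp | no q≢c   | no qc
      with two-free op c∈s mc | two-free op p∈s mp
    ...     | x , _ , _ , x-free , _ , cx , _ | d , f , d≢f , d-free , f-free , pd , pf =
      ⊥-elim (x-free s (closed op (inj₂ (inj₂ (inj₂ (inj₂ (inj₂ (inj₁
        (c , p , d , f , c∈s , p∈s , ─-sym cx , adjacent d-free pd , adjacent f-free pf , pd , pf , d≢f ,
         (λ { refl → d-free s c∈s }) , (λ { refl → f-free s c∈s }))))))))))
      where
      p≢c = ─⇒≢ (─-sym cp)
      q≢p = ─⇒≢ qp
      -- Otherwise r q p c x, with d attached to p, is an induced T.
      adjacent : ∀ {d} → Free d → p ─ d → x ─ d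
      adjacent {d} d-free pd = decidable-stable (x ─? d) λ xd →
        noT tfree (─-sym qr) qp (─-sym cp) cx pd
          (r-in p∈s mp (q≢p ∘ sym)) (r-in c∈s mc (q≢c ∘ sym)) (r-free x-free) (r-free d-free)
          qc (λ qx → q≢c (nbr-unique op x-free q∈s c∈s (─-sym qx) (─-sym cx)))
          (λ qd → q≢p (nbr-unique op d-free q∈s p∈s (─-sym qd) (─-sym pd)))
          (λ px → p≢c (nbr-unique op x-free p∈s c∈s (─-sym px) (─-sym cx)))
          (λ cd → p≢c (nbr-unique op d-free p∈s c∈s (─-sym pd) (─-sym cd)))
          xd

    module _ {s o} (op : Opposite s o) {c} (c∈s : In s c) (um : ¬ Matched o c) (near : Near s o c) where

      -- Otherwise r q c d e, with u attached to c, is an induced T.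
      dominating : ∀ {d e} → Free d → Free e → c ─ d → d ─ e → Dominates s c e
      dominating {d} {e} d-free e-free cd de u cu with side op u
      ... | inj₁ u∈s = inj₁ u∈s
      ... | inj₂ (inj₁ u∈o) = ⊥-elim (um (u , u∈o , cu))
      ... | inj₂ (inj₂ u-free) with u ≟ᶠ d
      ...   | yes refl = inj₂ (─-sym de)
      ...   | no u≢d =
        let q , (q∈s , r , qr , r-in , r-free , q-free) , qc = near
            q≢c = ─⇒≢ qc
        in inj₂ (decidable-stable (e ─? u) λ eu →
          noT tfree (─-sym qr) qc cd de cu
            (r-in c∈s um (q≢c ∘ sym)) (r-free d-free) (r-free e-free) (r-free u-free)
            (λ qd → q≢c (nbr-unique op d-free q∈s c∈s (─-sym qd) (─-sym cd)))
            (λ qe → q-free e-free d-free qe (─-sym de))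
            (λ qu → q≢c (nbr-unique op u-free q∈s c∈s (─-sym qu) (─-sym cu)))
            (no-triangle op c∈s d-free cd de)
            (λ du → no-triangle op c∈s d-free cd du cu)
            eu)

      -- By `dominating`, every free neighbour `d′` of `c` is adjacent to `e`. A further neighbour
      -- of `d′` would together with `e` trigger `pair`, so `d′` has the neighbours `c` and `e`
      -- only. Two such vertices form a lock, and `lockEnd` colours `e`.
      no-free-path-near : ∀ {d e} → Free d → Free e → c ─ d → ¬ d ─ e
      no-free-path-near {d} {e} d-free e-free cd de with two-free op c∈s um
      ... | d₁ , d₂ , d₁≢d₂ , d₁-free , d₂-free , cd₁ , cd₂ =
        e-free o (lock-end op c∈s (d₁≢d₂ , c≢e , twin d₁-free cd₁ , twin d₂-free cd₂))
        where
        c≢e : c ≢ e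
        c≢e refl = e-free s c∈s
        dom = dominating d-free e-free cd de
        twin : ∀ {d′} → Free d′ → c ─ d′ → Between d′ c e
        twin {d′} d′-free cd′ with dom d′ cd′
        ... | inj₁ d′∈s = ⊥-elim (d′-free s d′∈s)
        ... | inj₂ ed′ = ─-sym cd′ , ─-sym ed′ , only
          where
          two-others : ∀ {h} → d′ ─ h → h ≢ c → h ≢ e → ¬ (In o h ⊎ Dominates s c h)
          two-others d′h h≢c h≢e w = d′-free o (closed (opp op)
            (inj₂ (inj₂ (inj₂ (inj₂ (inj₂ (inj₂ (inj₁ (c , _ , e , c∈s , ─-sym cd′ , d′h , ─-sym ed′ ,
              h≢e , h≢c , c≢e ∘ sym , w , dom)))))))))
          only : ∀ h → d′ ─ h → h ≡ c ⊎ h ≡ e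
          only h d′h with h ≟ᶠ c | h ≟ᶠ e | side op h
          ... | yes eq | _      | _ = inj₁ eq
          ... | no _   | yes eq | _ = inj₂ eq
          ... | no h≢c | no h≢e | inj₁ h∈s = ⊥-elim (h≢c (nbr-unique op d′-free h∈s c∈s d′h (─-sym cd′)))
          ... | no h≢c | no h≢e | inj₂ (inj₁ h∈o) = ⊥-elim (two-others d′h h≢c h≢e (inj₁ h∈o))
          ... | no h≢c | no h≢e | inj₂ (inj₂ h-free) =
            ⊥-elim (two-others d′h h≢c h≢e (inj₂ (dominating d′-free h-free cd′ d′h)))

    no-free-path : ∀ {s o} → Opposite s o → ∀ {c d e} → In s c → Free d → Free e → c ─ d → ¬ d ─ e
    no-free-path op c∈s d-free e-free cd with anchored-or-near op c∈s (rooted op c∈s)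
    ... | inj₁ (_ , _ , _ , _ , _ , c-free) = c-free d-free e-free cd
    ... | inj₂ near = no-free-path-near op c∈s (unmatched op c∈s d-free cd) near d-free e-free cd

    -- By `leaf`, `d` has a neighbour besides `c`. Any such neighbour is not in `s` by `twoNbrs` and
    -- not free by `no-free-path`, so it is in `o`, where `twoNbrs` again allows only one.
    link : ∀ {s o} → Opposite s o → ∀ {c d} → In s c → Free d → c ─ d → ∃[ h ] In o h × Between d c h
    link {s} {o} op {c} {d} c∈s d-free cd with any? (λ h → ¬? (h ≟ᶠ c) ×-dec (d ─? h))
    ... | no none = ⊥-elim (d-free o (closed (opp op) (inj₂ (inj₂ (inj₂ (inj₂ (inj₁
          (c , c∈s , ─-sym cd , λ w dw → decidable-stable (w ≟ᶠ c) λ w≢c → none (w , w≢c , dw)))))))))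
    ... | yes (h , h≢c , dh) = h , h∈o , ─-sym cd , dh , only
      where
      other : ∀ {w} → w ≢ c → d ─ w → In o w
      other {w} w≢c dw with side op w
      ... | inj₁ w∈s = ⊥-elim (w≢c (nbr-unique op d-free w∈s c∈s dw (─-sym cd)))
      ... | inj₂ (inj₁ w∈o) = w∈o
      ... | inj₂ (inj₂ w-free) = ⊥-elim (no-free-path op c∈s d-free w-free cd dw)
      h∈o = other h≢c dh
      only : ∀ w → d ─ w → w ≡ c ⊎ w ≡ h
      only w dw with w ≟ᶠ c
      ... | yes eq = inj₁ eq
      ... | no w≢c = inj₂ (nbr-unique (opp op) d-free (other w≢c dw) h∈o dw dh)

-- Extending a closed state to a colouring

module _ {n : ℕ} where

  IsInvolutionOn : (Fin n → Set) → (Fin n → Fin n) → Set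
  IsInvolutionOn Q α = ∀ {x} → Q x → Q (α x) × α (α x) ≡ x × α x ≢ x

  -- The edges x ─ α x and x ─ β x form even cycles.  The cycle through d
  -- is shortened by removing d and α d and joining their β-neighbours.
  two-colouring : ∀ k (Q : Fin n → Set) → (∀ x → Dec (Q x)) → (∀ {x} → Q x → toℕ x < k) →
    ∀ α β → IsInvolutionOn Q α → IsInvolutionOn Q β →
    Σ (Fin n → Bool) λ z → ∀ {x} → Q x → z (α x) ≡ not (z x) × z (β x) ≡ not (z x)
  two-colouring zero    Q Q? Q< α β invα invβ = (λ _ → true) , λ q → contradiction (Q< q) λ ()
  two-colouring (suc k) Q Q? Q< α β invα invβ with any? (λ d → (toℕ d ≟ k) ×-dec Q? d)
  ... | no none = two-colouring k Q Q?
                    (λ {x} q → ≤∧≢⇒< (s≤s⁻¹ (Q< q)) (λ eq → none (x , eq , q))) α β invα invβ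
  ... | yes (d , d≡k , qd) = z , coloured
    where
    f = α d
    qf : Q f
    qf = proj₁ (invα qd)
    f≢d : f ≢ d
    f≢d = proj₂ (proj₂ (invα qd))
    αf : α f ≡ d
    αf = proj₁ (proj₂ (invα qd))

    Q′ : Fin n → Set
    Q′ x = Q x × x ≢ d × x ≢ f

    flipβ : ∀ {x y} → Q x → β x ≡ y → x ≡ β y
    flipβ q refl = sym (proj₁ (proj₂ (invβ q)))

    flipα : ∀ {x y} → Q x → α x ≡ y → x ≡ α y
    flipα q refl = sym (proj₁ (proj₂ (invα q)))

    β′ : Fin n → Fin n
    β′ x with β x ≟ᶠ d | β x ≟ᶠ f
    ... | yes _ | _     = β f
    ... | no _  | yes _ = β d
    ... | no _  | no _  = β x

    β′-d : ∀ {x} → β x ≡ d → β′ x ≡ β f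
    β′-d {x} eq with β x ≟ᶠ d
    ... | yes _ = refl
    ... | no ne = contradiction eq ne

    β′-f : ∀ {x} → β x ≡ f → β′ x ≡ β d
    β′-f {x} eq with β x ≟ᶠ d | β x ≟ᶠ f
    ... | yes eq′ | _     = contradiction (trans (sym eq) eq′) f≢d
    ... | no _    | yes _ = refl
    ... | no _    | no ne = contradiction eq ne

    β′-else : ∀ {x} → β x ≢ d → β x ≢ f → β′ x ≡ β x
    β′-else {x} ne ne′ with β x ≟ᶠ d | β x ≟ᶠ f
    ... | yes eq | _      = contradiction eq ne
    ... | no _   | yes eq = contradiction eq ne′
    ... | no _   | no _   = refl

    invα′ : IsInvolutionOn Q′ α
    invα′ (q , x≢d , x≢f) =
      (proj₁ (invα q) , (λ eq → x≢f (flipα q eq)) , (λ eq → x≢d (trans (flipα q eq) αf))) , proj₂ (invα q)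

    ββ : ∀ {x} → Q x → β (β x) ≡ x
    ββ q = proj₁ (proj₂ (invβ q))

    invβ′ : IsInvolutionOn Q′ β′
    invβ′ {x} (q , x≢d , x≢f) with β x ≟ᶠ d | β x ≟ᶠ f
    ... | yes eq | _ =
      (proj₁ (invβ qf) , (λ eq′ → x≢f (trans (flipβ q eq) (sym (flipβ qf eq′)))) , proj₂ (proj₂ (invβ qf))) ,
      trans (β′-f (ββ qf)) (sym (flipβ q eq)) ,
      (λ eq′ → f≢d (trans (flipβ qf eq′) eq))
    ... | no ne | yes eq =
      (proj₁ (invβ qd) , proj₂ (proj₂ (invβ qd)) , (λ eq′ → x≢d (trans (flipβ q eq) (sym (flipβ qd eq′))))) ,
      trans (β′-d (ββ qd)) (sym (flipβ q eq)) ,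
      (λ eq′ → f≢d (sym (trans (flipβ qd eq′) eq)))
    ... | no ne | no ne′ =
      (proj₁ (invβ q) , ne , ne′) ,
      trans (β′-else (x≢d ∘ trans (sym (ββ q))) (x≢f ∘ trans (sym (ββ q)))) (ββ q) ,
      proj₂ (proj₂ (invβ q))

    Q′? : ∀ x → Dec (Q′ x)
    Q′? x = Q? x ×-dec (¬? (x ≟ᶠ d) ×-dec ¬? (x ≟ᶠ f))

    smaller : ∀ {x} → Q′ x → toℕ x < k
    smaller (q , x≢d , _) = ≤∧≢⇒< (s≤s⁻¹ (Q< q)) (λ eq → x≢d (toℕ-injective (trans eq (sym d≡k))))

    rec = two-colouring k Q′ Q′? smaller α β′ invα′ invβ′
    z′ = proj₁ rec

    -- If `β d ≡ f`, the cycle consists of `d` and `f` alone and `z′ (β d)` is merely some value;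
    -- otherwise `β d` survives in `Q′` and dictates the colour of `d`.
    z : Fin n → Bool
    z x with x ≟ᶠ d | x ≟ᶠ f
    ... | yes _ | _     = not (z′ (β d))
    ... | no _  | yes _ = z′ (β d)
    ... | no _  | no _  = z′ x

    z-d : ∀ {x} → x ≡ d → z x ≡ not (z′ (β d))
    z-d {x} eq with x ≟ᶠ d
    ... | yes _ = refl
    ... | no ne = contradiction eq ne

    z-f : ∀ {x} → x ≡ f → z x ≡ z′ (β d)
    z-f {x} eq with x ≟ᶠ d | x ≟ᶠ f
    ... | yes eq′ | _     = contradiction (trans (sym eq) eq′) f≢d
    ... | no _    | yes _ = refl
    ... | no _    | no ne = contradiction eq ne

    z-else : ∀ {x} → x ≢ d → x ≢ f → z x ≡ z′ x
    z-else {x} ne ne′ with x ≟ᶠ d | x ≟ᶠ f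
    ... | yes eq | _      = contradiction eq ne
    ... | no _   | yes eq = contradiction eq ne′
    ... | no _   | no _   = refl

    z-βd : β d ≢ f → z (β d) ≡ z′ (β d)
    z-βd ne = z-else (proj₂ (proj₂ (invβ qd))) ne

    coloured : ∀ {x} → Q x → z (α x) ≡ not (z x) × z (β x) ≡ not (z x)
    coloured {x} q = go (x ≟ᶠ d) (x ≟ᶠ f)
      where
      go : Dec (x ≡ d) → Dec (x ≡ f) → z (α x) ≡ not (z x) × z (β x) ≡ not (z x)
      go (yes refl) _ = trans (z-f refl) (trans (sym (not-involutive _)) (cong not (sym (z-d refl)))) , βd (β d ≟ᶠ f)
        where
        βd : Dec (β d ≡ f) → z (β d) ≡ not (z d)
        βd (yes eq) = trans (z-f eq) (trans (sym (not-involutive _)) (cong not (sym (z-d refl))))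
        βd (no ne)  = trans (z-βd ne) (trans (sym (not-involutive _)) (cong not (sym (z-d refl))))
      go (no x≢d) (yes refl) = trans (z-d αf) (cong not (sym (z-f refl))) , βf (β d ≟ᶠ f)
        where
        βf : Dec (β d ≡ f) → z (β f) ≡ not (z f)
        βf (yes eq) = trans (z-d (sym (flipβ qd eq))) (cong not (sym (z-f refl)))
        βf (no ne)  = begin
          z (β f)          ≡⟨ z-else (λ eq → ne (sym (flipβ qf eq))) (proj₂ (proj₂ (invβ qf))) ⟩
          z′ (β f)         ≡⟨ cong z′ (β′-d (ββ qd)) ⟨
          z′ (β′ (β d))    ≡⟨ proj₂ (proj₂ rec (proj₁ (invβ qd) , proj₂ (proj₂ (invβ qd)) , ne)) ⟩
          not (z′ (β d))   ≡⟨ cong not (z-f refl) ⟨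
          not (z f)        ∎
          where open ≡-Reasoning
      go (no x≢d) (no x≢f) =
        trans (z-else (proj₁ (proj₂ αx)) (proj₂ (proj₂ αx))) (trans (proj₁ (proj₂ rec q′)) (cong not (sym z≡))) ,
        βx (β x ≟ᶠ d) (β x ≟ᶠ f)
        where
        q′ : Q′ x
        q′ = q , x≢d , x≢f
        αx = proj₁ (invα′ q′)
        z≡ = z-else x≢d x≢f
        βx : Dec (β x ≡ d) → Dec (β x ≡ f) → z (β x) ≡ not (z x)
        βx (yes eq) _ = trans (z-d eq) (cong not (trans (cong z′ (sym (flipβ q eq))) (sym z≡)))
        βx (no _) (yes eq) =
          trans (z-f eq) (trans (cong z′ (sym (β′-f eq))) (trans (proj₂ (proj₂ rec q′)) (cong not (sym z≡))))
        βx (no ne) (no ne′) =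
          trans (z-else ne ne′) (trans (cong z′ (sym (β′-else ne ne′))) (trans (proj₂ (proj₂ rec q′)) (cong not (sym z≡))))

Proper : (G : Graph) → (Fin (order G) → Bool) → Fin (order G) → Set
Proper G x u = ∃! _≡_ λ w → adj G u w ≡ true × x w ≡ not (x u)

-- `W` may exceed `P`: closed under adjacency, it contains every vertex that matters for properness
-- on it, and decidability lets `glue` give precedence to one of two overlapping solutions.
record SolutionOn (G : Graph) (P : Fin (order G) → Set) : Set₁ where
  field
    W        : Fin (order G) → Set
    W?       : ∀ v → Dec (W v)
    covers   : ∀ {v} → P v → W v
    W-closed : ∀ {u v} → W u → adj G u v ≡ true → W v
    x        : Fin (order G) → Bool
    proper   : ∀ {u} → W u → Proper G x u

opposite-not : ∀ {s o} → Opposite s o → o ≡ not s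
opposite-not tf = refl
opposite-not ft = refl

clash : ∀ {s o} → Opposite s o → s ≢ o
clash tf ()
clash ft ()

module Solve (G : Graph) (tfree : (T -Free) G) (S : State (order G)) {k} (vs : Vec (Fin (order G)) k)
             (isClosed : Closed.IsClosed G tfree S vs) where
  open Notation G
  open InState S
  open Closed G tfree S vs
  open IsClosed isClosed
  open Facts isClosed

  Few : Set
  Few = ∀ {s o} → Opposite s o → ∀ {c d e f} → In s c → c ─ d → c ─ e → c ─ f →
        d ≢ e → d ≢ f → e ≢ f → Free d → Free e → ¬ Free f

  module _ (few : Few) where

    Other : Bool → V → V → Set
    Other s d f = ∃[ c ] In s c × d ─ c × c ─ f × Free f × f ≢ d

    free? : ∀ v → Dec (Free v)
    free? v with In? true v | In? false v
    ... | yes p | _     = no (λ q → q true p)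
    ... | no _  | yes p = no (λ q → q false p)
    ... | no p  | no q  = yes (free tf p q)

    other? : ∀ s d → Dec (∃ (Other s d))
    other? s d = any? λ f → any? λ c →
      In? s c ×-dec ((d ─? c) ×-dec ((c ─? f) ×-dec (free? f ×-dec ¬? (f ≟ᶠ d))))

    other : Bool → V → V
    other s d with other? s d
    ... | yes (f , _) = f
    -- A default, which `other-correct` excludes for the vertices in question.
    ... | no _        = d

    other-correct : ∀ {s o} → Opposite s o → ∀ {d} → Free d → Matched s d → Other s d (other s d)
    other-correct {s} op {d} d-free (c , c∈s , dc) with other? s d
    ... | yes (f , spec) = spec
    ... | no none with two-free op c∈s (unmatched op c∈s d-free (─-sym dc))
    ...   | f , g , f≢g , f-free , g-free , cf , cg with f ≟ᶠ d
    ...     | no f≢d   = ⊥-elim (none (f , c , c∈s , dc , cf , f-free , f≢d))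
    ...     | yes refl = ⊥-elim (none (g , c , c∈s , dc , cg , g-free , f≢g ∘ sym))

    Linked : V → Set
    Linked d = Free d × Matched true d

    cross : ∀ {s o} → Opposite s o → ∀ {d} → Free d → Matched s d → Matched o d
    cross op d-free (c , c∈s , dc) with link op c∈s d-free (─-sym dc)
    ... | h , h∈o , _ , dh , _ = h , h∈o , dh

    linked : ∀ {s o} → Opposite s o → ∀ {d} → Free d → Matched s d → Linked d
    linked tf d-free m = d-free , m
    linked ft d-free m = d-free , cross ft d-free m

    matched : ∀ {s o} → Opposite s o → ∀ {d} → Linked d → Matched s d
    matched tf (d-free , m) = m
    matched ft (d-free , m) = cross tf d-free m

    -- The free vertex `f` has the same neighbour `c` in `s` as `d`. If the vertex reached from `f`
    -- were not `d`, then `c` would have three free neighbours, against `few`.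
    other-involution : ∀ {s o} → Opposite s o → IsInvolutionOn Linked (other s)
    other-involution {s} op {d} q with other-correct op (proj₁ q) (matched op q)
    ... | c , c∈s , dc , cf , f-free , f≢d
      with other-correct op f-free (c , c∈s , ─-sym cf)
    ...   | c′ , c′∈s , fc′ , c′g , g-free , g≢f with nbr-unique op f-free c′∈s c∈s fc′ (─-sym cf)
    ...     | refl = linked op f-free (c , c∈s , ─-sym cf) ,
                     decidable-stable (_ ≟ᶠ d) (λ g≢d →
                       few op c∈s (─-sym dc) cf c′g (f≢d ∘ sym) (g≢d ∘ sym) (g≢f ∘ sym) (proj₁ q) f-free g-free) ,
                     f≢d

    module Coloured (z : V → Bool) (z-other : ∀ {s o} → Opposite s o → ∀ {d} → Linked d → z (other s d) ≡ not (z d)) where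

      x : V → Bool
      x v with In? true v | In? false v
      ... | yes _ | _     = true
      ... | no _  | yes _ = false
      ... | no _  | no _  = z v

      x-in : ∀ {s o} → Opposite s o → ∀ {v} → In s v → x v ≡ s
      x-in op {v} v∈s with In? true v | In? false v
      x-in tf v∈s | yes _ | _     = refl
      x-in ft v∈s | yes p | _     = ⊥-elim (disjoint tf p v∈s)
      x-in tf v∈s | no p  | _     = ⊥-elim (p v∈s)
      x-in ft v∈s | no _  | yes _ = refl
      x-in ft v∈s | no _  | no p  = ⊥-elim (p v∈s)

      x-free : ∀ {v} → Free v → x v ≡ z v
      x-free {v} v-free with In? true v | In? false v
      ... | yes p | _     = ⊥-elim (v-free true p)
      ... | no _  | yes p = ⊥-elim (v-free false p)
      ... | no _  | no _  = refl

      Opp : V → V → Set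
      Opp u w = u ─ w × x w ≡ not (x u)

      -- A matched `c` has no free neighbours and only one in `o`. An unmatched `c` has exactly the
      -- free neighbours `d` and `other s d`, and `z` gives these different colours.
      proper-in : ∀ {s o} → Opposite s o → ∀ {c} → In s c → Proper G x c
      proper-in {s} {o} op {c} c∈s with Matched? o c
      ... | yes (w , w∈o , cw) = w , (cw , trans (x-in (opp op) w∈o) o≡) , unique
        where
        o≡ : o ≡ not (x c)
        o≡ = trans (opposite-not op) (cong not (sym (x-in op c∈s)))
        unique : ∀ {y} → Opp c y → w ≡ y
        unique {y} (cy , xy) with side op y
        ... | inj₁ y∈s = ⊥-elim (clash op (trans (sym (x-in op y∈s)) (trans xy (sym o≡))))
        ... | inj₂ (inj₂ y-free) = ⊥-elim (matched-nbr op c∈s (w , w∈o , cw) y-free cy)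
        ... | inj₂ (inj₁ y∈o) = decidable-stable (w ≟ᶠ y) λ w≢y →
          disjoint (opp op) y∈o (closed op (inj₁ (c , w , c∈s , ─-sym cy , w∈o , cw , w≢y)))
      ... | no um with two-free op c∈s um
      ...   | d , _ , _ , d-free , _ , cd , _ = go (z d ≟ᵇ o)
        where
        o≡ : o ≡ not (x c)
        o≡ = trans (opposite-not op) (cong not (sym (x-in op c∈s)))
        s≡ : s ≡ not o
        s≡ = opposite-not (opp op)
        f = other s d
        lk = linked op d-free (c , c∈s , ─-sym cd)
        spec = other-correct op d-free (c , c∈s , ─-sym cd)
        f-free : Free f
        f-free = proj₁ (proj₂ (proj₂ (proj₂ (proj₂ spec))))
        f≢d = proj₂ (proj₂ (proj₂ (proj₂ (proj₂ spec))))
        cf : c ─ f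
        cf = subst (_─ f) (nbr-unique op d-free (proj₁ (proj₂ spec)) c∈s (proj₁ (proj₂ (proj₂ spec))) (─-sym cd))
               (proj₁ (proj₂ (proj₂ (proj₂ spec))))
        candidates : ∀ {y} → Opp c y → y ≡ d ⊎ y ≡ f
        candidates {y} (cy , xy) with side op y
        ... | inj₁ y∈s = ⊥-elim (clash op (trans (sym (x-in op y∈s)) (trans xy (sym o≡))))
        ... | inj₂ (inj₁ y∈o) = ⊥-elim (um (y , y∈o , cy))
        ... | inj₂ (inj₂ y-free) with y ≟ᶠ d | y ≟ᶠ f
        ...   | yes eq | _      = inj₁ eq
        ...   | no _   | yes eq = inj₂ eq
        ...   | no y≢d | no y≢f = ⊥-elim (few op c∈s cd cf cy (f≢d ∘ sym) (y≢d ∘ sym) (y≢f ∘ sym) d-free f-free y-free)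
        go : Dec (z d ≡ o) → Proper G x c
        go (yes zd) = d , (cd , trans (x-free d-free) (trans zd o≡)) , unique
          where
          unique : ∀ {y} → Opp c y → d ≡ y
          unique ox with candidates ox
          ... | inj₁ eq = sym eq
          ... | inj₂ refl = ⊥-elim (clash op (trans s≡ (trans (cong not (sym zd)) (trans (sym (z-other op lk))
                              (trans (sym (x-free f-free)) (trans (proj₂ ox) (sym o≡)))))))
        go (no zd) = f , (cf , trans (x-free f-free) (trans (z-other op lk) (trans (sym (¬-not (zd ∘ sym))) o≡))) , unique
          where
          unique : ∀ {y} → Opp c y → f ≡ y
          unique ox with candidates ox
          ... | inj₂ eq = sym eq
          ... | inj₁ refl = ⊥-elim (zd (trans (sym (x-free d-free)) (trans (proj₂ ox) (sym o≡))))

      proper-free : ∀ {d} → Linked d → Proper G x d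
      proper-free {d} (d-free , c , c∈ , dc) with link tf c∈ d-free (─-sym dc)
      ... | h , h∈ , _ , dh , only with z d in zd
      ...   | true  = h , (dh , trans (x-in ft h∈) (cong not (sym xd))) , unique
        where
        xd = trans (x-free d-free) zd
        unique : ∀ {y} → Opp d y → h ≡ y
        unique (dy , xy) with only _ dy
        ... | inj₂ refl = refl
        ... | inj₁ refl with trans (sym (x-in tf c∈)) (trans xy (cong not xd))
        ...   | ()
      ...   | false = c , (dc , trans (x-in tf c∈) (cong not (sym xd))) , unique
        where
        xd = trans (x-free d-free) zd
        unique : ∀ {y} → Opp d y → c ≡ y
        unique (dy , xy) with only _ dy
        ... | inj₁ refl = refl
        ... | inj₂ refl with trans (sym (x-in ft h∈)) (trans xy (cong not xd))
        ...   | ()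

      local : ∀ {a} → In true a → SolutionOn G (_≡ a)
      local {a} a∈ = record
        { W = W ; W? = λ v → In? true v ⊎-dec (In? false v ⊎-dec (free? v ×-dec Matched? true v))
        ; covers = λ { refl → inj₁ a∈ } ; W-closed = W-closed ; x = x
        ; proper = λ { (inj₁ p) → proper-in tf p ; (inj₂ (inj₁ p)) → proper-in ft p ; (inj₂ (inj₂ p)) → proper-free p } }
        where
        W : V → Set
        W v = In true v ⊎ In false v ⊎ Linked v
        nbr : ∀ {s o} → Opposite s o → ∀ {u v} → In s u → u ─ v → W v
        nbr op {u} {v} u∈s uv with side tf v
        ... | inj₁ p        = inj₁ p
        ... | inj₂ (inj₁ p) = inj₂ (inj₁ p)
        ... | inj₂ (inj₂ p) = inj₂ (inj₂ (linked op p (u , u∈s , ─-sym uv)))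
        W-closed : ∀ {u v} → W u → u ─ v → W v
        W-closed (inj₁ p) uv = nbr tf p uv
        W-closed (inj₂ (inj₁ p)) uv = nbr ft p uv
        W-closed {u} {v} (inj₂ (inj₂ (d-free , c , c∈ , dc))) uv with link tf c∈ d-free (─-sym dc)
        ... | h , h∈ , _ , dh , only with only v uv
        ...   | inj₁ refl = inj₁ c∈
        ...   | inj₂ refl = inj₂ (inj₁ h∈)

    local-solution : ∀ {a} → In true a → SolutionOn G (_≡ a)
    local-solution = Coloured.local (proj₁ colouring) z-other
      where
      colouring = two-colouring n Linked (λ d → free? d ×-dec Matched? true d) (λ {x} _ → toℕ<n x)
                    (other true) (other false) (other-involution tf) (other-involution ft)
      z-other : ∀ {s o} → Opposite s o → ∀ {d} → Linked d → proj₁ colouring (other s d) ≡ not (proj₁ colouring d)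
      z-other tf q = proj₁ (proj₂ colouring q)
      z-other ft q = proj₂ (proj₂ colouring q)

-- Gluing of local solutions; colourings and cuts

module _ {G : Graph} where
  open Notation G

  proper-cong : ∀ {x x′ u} → x u ≡ x′ u → (∀ {w} → u ─ w → x w ≡ x′ w) → Proper G x u → Proper G x′ u
  proper-cong eq eqs (w , (uw , xw) , unique) =
    w , (uw , trans (sym (eqs uw)) (trans xw (cong not eq))) ,
    λ (uy , xy) → unique (uy , trans (eqs uy) (trans xy (cong not (sym eq))))

  -- A later solution never changes the colours of an earlier one, since
  -- the vertices coloured earlier form a union of components.
  glue : (∀ a → SolutionOn G (_≡ a)) → ∀ m → m ≤ n → SolutionOn G (λ v → toℕ v < m)
  glue sol zero    m≤n = record
    { W = λ _ → ⊥ ; W? = λ _ → no id ; covers = λ () ; W-closed = λ () ; x = λ _ → true ; proper = λ () }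
  glue sol (suc m) m<n = record
    { W = W ; W? = λ v → L.W? v ⊎-dec R.W? v ; covers = covers ; W-closed = W-closed ; x = x ; proper = proper }
    where
    a = fromℕ< m<n
    module L = SolutionOn (glue sol m (≤-trans (n≤1+n m) m<n))
    module R = SolutionOn (sol a)
    W : V → Set
    W v = L.W v ⊎ R.W v
    covers : ∀ {v} → toℕ v < suc m → W v
    covers v<m with m≤n⇒m<n∨m≡n (s≤s⁻¹ v<m)
    ... | inj₁ v<m = inj₁ (L.covers v<m)
    ... | inj₂ v≡m = inj₂ (R.covers (toℕ-injective (trans v≡m (sym (toℕ-fromℕ< m<n)))))
    W-closed : ∀ {u v} → W u → u ─ v → W v
    W-closed (inj₁ p) uv = inj₁ (L.W-closed p uv)
    W-closed (inj₂ p) uv = inj₂ (R.W-closed p uv)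
    x : V → Bool
    x v with L.W? v
    ... | yes _ = L.x v
    ... | no _  = R.x v
    x-L : ∀ {v} → L.W v → L.x v ≡ x v
    x-L {v} p with L.W? v
    ... | yes _ = refl
    ... | no ¬p = contradiction p ¬p
    x-R : ∀ {v} → ¬ L.W v → R.x v ≡ x v
    x-R {v} ¬p with L.W? v
    ... | yes p = contradiction p ¬p
    ... | no _  = refl
    proper : ∀ {u} → W u → Proper G x u
    proper {u} p = go (L.W? u) p
      where
      go : Dec (L.W u) → W u → Proper G x u
      go (yes q) _        = proper-cong (x-L q) (λ uw → x-L (L.W-closed q uw)) (L.proper q)
      go (no ¬q) (inj₁ q) = contradiction q ¬q
      go (no ¬q) (inj₂ r) = proper-cong (x-R ¬q) (λ uw → x-R (λ q → ¬q (L.W-closed q (─-sym uw)))) (R.proper r)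

  proper⇒cut : (x : V → Bool) → (∀ u → Proper G x u) → V → HasPerfectMatchingCut G
  proper⇒cut x proper v₀ = cut , matching
    where
    in⁺ : ∀ {f : V → Bool} {v} → f v ≡ true → v ∈ˢ tabulate f
    in⁺ {f} {v} eq = lookup⇒[]= v (tabulate f) (trans (lookup∘tabulate f v) eq)
    in⁻ : ∀ {f : V → Bool} {v} → v ∈ˢ tabulate f → f v ≡ true
    in⁻ {f} {v} p = trans (sym (lookup∘tabulate f v)) ([]=⇒lookup p)
    X = tabulate x
    Y = tabulate (not ∘ x)
    w₀ = proj₁ (proper v₀)
    xw₀ = proj₂ (proj₁ (proj₂ (proper v₀)))
    nonempty : ∀ b → x v₀ ≡ b → (∃ (_∈ˢ X)) × (∃ (_∈ˢ Y))
    nonempty true  eq = (v₀ , in⁺ eq) , (w₀ , in⁺ (cong not (trans xw₀ (cong not eq))))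
    nonempty false eq = (w₀ , in⁺ (trans xw₀ (cong not eq))) , (v₀ , in⁺ (cong not eq))
    cover : ∀ b v → x v ≡ b → v ∈ˢ X ⊎ v ∈ˢ Y
    cover true  v eq = inj₁ (in⁺ eq)
    cover false v eq = inj₂ (in⁺ (cong not eq))
    true≢false : ∀ {b} → b ≡ true → not b ≡ true → ⊥
    true≢false refl ()
    cut : Cut G
    cut = record
      { X = X ; Y = Y
      ; nonemptyX = proj₁ (nonempty _ refl) ; nonemptyY = proj₂ (nonempty _ refl)
      ; disjoint = λ (v , v∈) → true≢false (in⁻ (proj₁ (x∈p∩q⁻ X Y v∈))) (in⁻ (proj₂ (x∈p∩q⁻ X Y v∈)))
      ; cover = λ v → cover _ v refl }
    member⁺ : ∀ b {v u} → x v ≡ b → x u ≡ not (x v) → v ∈ˢ X × u ∈ˢ Y ⊎ v ∈ˢ Y × u ∈ˢ X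
    member⁺ true  eq xu = inj₁ (in⁺ eq , in⁺ (cong not (trans xu (cong not eq))))
    member⁺ false eq xu = inj₂ (in⁺ (cong not eq) , in⁺ (trans xu (cong not eq)))
    opposite : ∀ {a b} → a ≡ true → not b ≡ true → b ≡ not a
    opposite {b = false} refl refl = refl
    member⁻ : ∀ {v u} → v ∈ˢ X × u ∈ˢ Y ⊎ v ∈ˢ Y × u ∈ˢ X → x u ≡ not (x v)
    member⁻ (inj₁ (v∈ , u∈)) = opposite (in⁻ v∈) (in⁻ u∈)
    member⁻ (inj₂ (v∈ , u∈)) = trans (sym (not-involutive _)) (cong not (sym (opposite (in⁻ u∈) (in⁻ v∈))))
    matching : IsPerfectMatching G (edgeCut G cut)
    matching v with proper v
    ... | w , (vw , xw) , unique = w , (vw , member⁺ _ refl xw) , λ (vy , m) → unique (vy , member⁻ m)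

  cut⇒proper : HasPerfectMatchingCut G → ∃ λ x → ∀ u → Proper G x u
  cut⇒proper (C , matching) = x , proper
    where
    open Cut C
    x : V → Bool
    x = lookup X
    in-Y : ∀ {v} → v ∈ˢ Y → x v ≡ false
    in-Y {v} p = ¬-not λ eq → disjoint (v , x∈p∩q⁺ (lookup⇒[]= v X eq , p))
    out-X : ∀ {v} → x v ≡ false → v ∈ˢ Y
    out-X {v} eq with cover v
    ... | inj₂ p = p
    ... | inj₁ p with trans (sym eq) ([]=⇒lookup p)
    ...   | ()
    member⁺ : ∀ {v u} → v ∈ˢ X × u ∈ˢ Y ⊎ v ∈ˢ Y × u ∈ˢ X → x u ≡ not (x v)
    member⁺ (inj₁ (v∈ , u∈)) = trans (in-Y u∈) (cong not (sym ([]=⇒lookup v∈)))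
    member⁺ (inj₂ (v∈ , u∈)) = trans ([]=⇒lookup u∈) (cong not (sym (in-Y v∈)))
    member⁻ : ∀ b {v u} → x v ≡ b → x u ≡ not (x v) → v ∈ˢ X × u ∈ˢ Y ⊎ v ∈ˢ Y × u ∈ˢ X
    member⁻ true  {v} eq xu = inj₁ (lookup⇒[]= v X eq , out-X (trans xu (cong not eq)))
    member⁻ false {v} {u} eq xu = inj₂ (out-X eq , lookup⇒[]= u X (trans xu (cong not eq)))
    proper : ∀ u → Proper G x u
    proper u with matching u
    ... | w , (uw , m) , unique = w , (uw , member⁺ m) , λ (uy , xy) → unique (uy , member⁻ _ refl xy)

-- Soundness of the rules, and the counting argument

module Partner (G : Graph) (y : Fin (order G) → Bool) (proper : ∀ u → Proper G y u) where
  open Notation G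

  partner : V → V
  partner u = proj₁ (proper u)

  partner-adj : ∀ u → u ─ partner u
  partner-adj u = proj₁ (proj₁ (proj₂ (proper u)))

  partner-colour : ∀ u → y (partner u) ≡ not (y u)
  partner-colour u = proj₂ (proj₁ (proj₂ (proper u)))

  partner-unique : ∀ {u w} → u ─ w → y w ≡ not (y u) → partner u ≡ w
  partner-unique {u} uw yw = proj₂ (proj₂ (proper u)) (uw , yw)

  partner-involutive : ∀ u → partner (partner u) ≡ u
  partner-involutive u = partner-unique (─-sym (partner-adj u))
    (trans (sym (not-involutive (y u))) (cong not (sym (partner-colour u))))

  partner-injective : ∀ {u v} → partner u ≡ partner v → u ≡ v
  partner-injective {u} {v} eq = trans (sym (partner-involutive u)) (trans (cong partner eq) (partner-involutive v))

  module _ {s o} (op : Opposite s o) where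

    not-o : ∀ {v} → y v ≢ o → y v ≡ s
    not-o ne = trans (¬-not ne) (sym (opposite-not (opp op)))

    one-opposite : ∀ {u w w′} → y u ≡ s → u ─ w → u ─ w′ → y w ≡ o → y w′ ≡ o → w ≡ w′
    one-opposite {u} yu uw uw′ yw yw′ = trans (sym (partner-unique uw (flip′ yw))) (partner-unique uw′ (flip′ yw′))
      where
      flip′ : ∀ {w} → y w ≡ o → y w ≡ not (y u)
      flip′ eq = trans eq (trans (opposite-not op) (cong not (sym yu)))

    partner-o : ∀ {u} → y u ≡ s → y (partner u) ≡ o
    partner-o {u} yu = trans (partner-colour u) (trans (cong not yu) (sym (opposite-not op)))

  -- Suppose `e` had the colour of `c`. The partner of `d` is one of the two, so `d` has the other
  -- colour; but then both are partners of `d`.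
  lock-sound : ∀ {s o} → Opposite s o → ∀ {c e d f} → y c ≡ s → Lock c e d f → y e ≡ o
  lock-sound {s} {o} op {c} {e} {d} {f} yc (d≢f , c≢e , (dc , de , d!) , (fc , fe , f!)) =
    not-o (opp op) λ ye → c≢e (one-opposite (opp op) (not-o (opp op) (λ yd → side ye yd (d! _ (partner-adj d)))) dc de yc ye)
    where
    side : y e ≡ s → y d ≡ s → partner d ≡ c ⊎ partner d ≡ e → ⊥
    side ye yd (inj₁ eq) = clash op (trans (sym yc) (trans (cong y (sym eq)) (partner-o op yd)))
    side ye yd (inj₂ eq) = clash op (trans (sym ye) (trans (cong y (sym eq)) (partner-o op yd)))

  module Sound (S : State n) (sound : ∀ s v → InState.In S s v → y v ≡ s) {k} (vs : Vec V k) where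
    open InState S

    dominating-sound : ∀ {s o} → Opposite s o → ∀ {c w} → y c ≡ o → w ≢ c → Dominates o c w → y w ≡ s
    dominating-sound {s} {o} op {c} {w} yc w≢c dom with dom (partner c) (partner-adj c)
    ... | inj₁ q∈o = ⊥-elim (clash op (trans (sym (partner-o (opp op) yc)) (sound o _ q∈o)))
    ... | inj₂ wq  = not-o op λ yw →
      w≢c (one-opposite op (partner-o (opp op) yc) (─-sym wq) (─-sym (partner-adj c)) yw yc)

    -- Apart from `lastNbr`, `leaf` and `lockEnd`, placing `v` on side `o` gives some vertex two
    -- neighbours of the other colour: `v` itself, a coloured neighbour, `p` in `crossed`, or the
    -- far end `e` of the lock in `lockNbr`.
    rule-sound : ∀ {s o} → Opposite s o → ∀ {v} → Sat (rule s o) S (v ∷ vs) → y v ≡ s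
    rule-sound {s} {o} op {v} (inj₁ (u , w , u∈s , vu , w∈o , uw , w≢v)) =
      not-o op λ yv → w≢v (one-opposite op (sound s u u∈s) uw (─-sym vu) (sound o w w∈o) yv)
    rule-sound {s} {o} op {v} (inj₂ (inj₁ (u , w , u∈s , w∈s , u≢w , vu , vw))) =
      not-o op λ yv → u≢w (one-opposite (opp op) yv vu vw (sound s u u∈s) (sound s w w∈s))
    rule-sound {s} {o} op {v} (inj₂ (inj₂ (inj₁ (u , w , u∈s , vu , vw , uw)))) =
      not-o op λ yv → ─⇒≢ uw (one-opposite (opp op) yv vu vw (sound s u u∈s)
        (not-o op λ yw → ─⇒≢ vw (one-opposite op (sound s u u∈s) (─-sym vu) uw yv yw)))
    rule-sound {s} {o} op {v} (inj₂ (inj₂ (inj₂ (inj₁ (u , u∈o , vu , last))))) with last (partner u) (partner-adj u)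
    ... | inj₁ p∈o = ⊥-elim (clash op (trans (sym (partner-o (opp op) (sound o u u∈o))) (sound o _ p∈o)))
    ... | inj₂ eq  = trans (cong y (sym eq)) (partner-o (opp op) (sound o u u∈o))
    rule-sound {s} {o} op {v} (inj₂ (inj₂ (inj₂ (inj₂ (inj₁ (u , u∈o , vu , only)))))) =
      not-o op λ yv → clash op (trans (sym (partner-o (opp op) yv))
        (trans (cong y (only (partner v) (partner-adj v))) (sound o u u∈o)))
    rule-sound {s} {o} op {v} (inj₂ (inj₂ (inj₂ (inj₂ (inj₂ (inj₁
      (c , p , d , f , c∈s , p∈s , vc , vd , vf , pd , pf , d≢f , d≢c , f≢c))))))) =
      not-o op λ yv →
        let other : ∀ {d} → v ─ d → d ≢ c → y d ≡ o
            other vd d≢c = not-o (opp op) λ yd → d≢c (one-opposite (opp op) yv vd vc yd (sound s c c∈s))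
        in d≢f (one-opposite op (sound s p p∈s) pd pf (other vd d≢c) (other vf f≢c))
    rule-sound {s} {o} op {v} (inj₂ (inj₂ (inj₂ (inj₂ (inj₂ (inj₂ (inj₁
      (c , w₁ , w₂ , c∈o , vc , vw₁ , vw₂ , w₁≢w₂ , w₁≢c , w₂≢c , first , dom)))))))) =
      not-o op λ yv → w₁≢w₂ (one-opposite (opp op) yv vw₁ vw₂
        ([ sound s w₁ , dominating-sound op (sound o c c∈o) w₁≢c ]′ first)
        (dominating-sound op (sound o c c∈o) w₂≢c dom))
    rule-sound {s} {o} op (inj₂ (inj₂ (inj₂ (inj₂ (inj₂ (inj₂ (inj₂ (inj₁ (c , d , f , c∈o , l))))))))) =
      lock-sound (opp op) (sound o c c∈o) l
    rule-sound {s} {o} op {v} (inj₂ (inj₂ (inj₂ (inj₂ (inj₂ (inj₂ (inj₂ (inj₂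
      (c , e , d , f , c∈s , vc , l@(d≢f , c≢e , (dc , de , _) , (fc , fe , _)) , v≢d , v≢f))))))))) =
      not-o op λ yv →
        let yc = sound s c c∈s
            twin : ∀ {d} → d ─ c → v ≢ d → y d ≡ s
            twin dc v≢d = not-o op λ yd → v≢d (one-opposite op yc (─-sym vc) (─-sym dc) yv yd)
        in d≢f (one-opposite (opp op) (lock-sound op yc l) (─-sym de) (─-sym fe) (twin dc v≢d) (twin fc v≢f))

module Counting (G : Graph) (tfree : (T -Free) G) (S : State (order G)) {k} (vs : Vec (Fin (order G)) k)
                (isClosed : Closed.IsClosed G tfree S vs)
                (y : Fin (order G) → Bool) (proper : ∀ u → Proper G y u)
                (sound : ∀ s v → Notation.InState.In G S s v → y v ≡ s) where
  open Notation G
  open InState S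
  open Closed G tfree S vs
  open Facts isClosed
  open Partner G y proper

  Unmatched : Bool → Bool → V → Set
  Unmatched s o u = In s u × ¬ Matched o u

  Open : V → Set
  Open u = Unmatched true false u ⊎ Unmatched false true u

  open? : ∀ u → Dec (Open u)
  open? u = (In? true u ×-dec ¬? (Matched? false u)) ⊎-dec (In? false u ×-dec ¬? (Matched? true u))

  toOpen : ∀ {s o} → Opposite s o → ∀ {u} → Unmatched s o u → Open u
  toOpen tf = inj₁
  toOpen ft = inj₂

  Mate : V → V → Set
  Mate u d = Free d × u ─ d × y d ≡ y u

  -- Of two free neighbours, at most one is the partner.
  has-mate : ∀ {u} → Open u → ∃ (Mate u)
  has-mate = [ go tf , go ft ]′
    where
    go : ∀ {s o} → Opposite s o → ∀ {u} → Unmatched s o u → ∃ (Mate u)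
    go {s} {o} op {u} (u∈s , um) with two-free op u∈s um
    ... | d , f , d≢f , d-free , f-free , ud , uf with y d ≟ᵇ s | y f ≟ᵇ s
    ...   | yes yd | _      = d , d-free , ud , trans yd (sym (sound s u u∈s))
    ...   | no _   | yes yf = f , f-free , uf , trans yf (sym (sound s u u∈s))
    ...   | no yd  | no yf  = ⊥-elim (d≢f (one-opposite op (sound s u u∈s) ud uf (not-o (opp op) yd) (not-o (opp op) yf)))

  -- The partner of `d` cannot be `u`, which has the same colour, so it is the other neighbour of
  -- `d`. That one is open because matched vertices have no free neighbours.
  mate-link : ∀ {u d} → Open u → Mate u d → Open (partner d) × Between d u (partner d)
  mate-link = [ go tf , go ft ]′
    where
    go : ∀ {s o} → Opposite s o → ∀ {u d} → Unmatched s o u → Mate u d → Open (partner d) × Between d u (partner d)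
    go {s} {o} op {u} {d} (u∈s , _) (d-free , ud , yd) with link op u∈s d-free ud
    ... | h , h∈o , du , dh , only with only (partner d) (partner-adj d)
    ...   | inj₁ eq = ⊥-elim (not-¬ (trans (cong y eq) (sym yd)) (partner-colour d))
    ...   | inj₂ eq rewrite eq =
      toOpen (opp op) (h∈o , λ m → matched-nbr (opp op) h∈o m d-free (─-sym dh)) , du , dh , only

  -- Since d has two neighbours only, it is the mate of one of them.
  mate-unique : ∀ {u v d} → Open u → Mate u d → Mate v d → u ≡ v
  mate-unique ou mu@(_ , ud , yd) (_ , vd , yd′) with mate-link ou mu
  ... | _ , _ , _ , only with only _ (─-sym vd)
  ...   | inj₁ eq   = sym eq
  ...   | inj₂ refl = ⊥-elim (not-¬ (sym yd′) (partner-colour _))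

  mateOf : ∀ {u} → Dec (Open u) → V
  mateOf {u} (yes p) = proj₁ (has-mate p)
  mateOf {u} (no _)  = u

  mate : V → V
  mate u = mateOf (open? u)

  mate-correct : ∀ {u} → Open u → Mate u (mate u)
  mate-correct {u} p = go (open? u)
    where
    go : (p? : Dec (Open u)) → Mate u (mateOf p?)
    go (yes p′) = proj₂ (has-mate p′)
    go (no ¬p)  = contradiction p ¬p

  -- The identity on the remaining vertices turns the injection on open vertices into one on all
  -- vertices, ready for the pigeonhole principle.
  throughOf : ∀ u → Dec (Open u) → V
  throughOf u (yes _) = partner (mate u)
  throughOf u (no _)  = u

  through : V → V
  through u = throughOf u (open? u)

  partner-mate-open : ∀ {u} → Open u → Open (partner (mate u))
  partner-mate-open p = proj₁ (mate-link p (mate-correct p))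

  through-injective : ∀ {u v} → through u ≡ through v → u ≡ v
  through-injective {u} {v} = go (open? u) (open? v)
    where
    go : (p? : Dec (Open u)) (q? : Dec (Open v)) → throughOf u p? ≡ throughOf v q? → u ≡ v
    go (no ¬p) (no ¬q) eq = eq
    go (yes p) (no ¬q) eq = contradiction (subst Open eq (partner-mate-open p)) ¬q
    go (no ¬p) (yes q) eq = contradiction (subst Open (sym eq) (partner-mate-open q)) ¬p
    go (yes p) (yes q) eq = mate-unique p (mate-correct p) (subst (Mate v) (sym (partner-injective eq)) (mate-correct q))

  -- The injection u ↦ through u would still be injective after adding one
  -- more point, sent to the partner of d.
  one-mate : ∀ {u d} → Open u → Mate u d → d ≡ mate u
  one-mate {u} {d} p m = decidable-stable (d ≟ᶠ mate u) λ d≢ → collide d≢ (pigeonhole (n<1+n n) extended)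
    where
    extended : Fin (suc n) → V
    extended zero    = partner d
    extended (suc v) = through v
    missed : d ≢ mate u → ∀ v → partner d ≢ through v
    missed d≢ v = go (open? v)
      where
      go : (q? : Dec (Open v)) → partner d ≢ throughOf v q?
      go (no ¬q) eq = ¬q (subst Open eq (proj₁ (mate-link p m)))
      go (yes q) eq = d≢ (trans d≡ (cong mate (mate-unique q (mate-correct q) (subst (Mate u) d≡ m))))
        where d≡ = partner-injective eq
    collide : d ≢ mate u → ¬ (∃ λ i → ∃ λ j → i Fin.< j × extended i ≡ extended j)
    collide d≢ (zero  , suc j , _   , eq) = missed d≢ j eq
    collide d≢ (suc i , suc j , i<j , eq) = <⇒≢ i<j (cong suc (through-injective eq))
    collide d≢ (i , zero , () , eq)

  module _ {s o} (op : Opposite s o) {c} (c∈s : In s c) where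

    same : ∀ {d e} → Free d → Free e → c ─ d → c ─ e → y d ≡ s → y e ≡ s → d ≡ e
    same d-free e-free cd ce yd ye = trans (one-mate c-open (d-free , cd , trans yd (sym yc)))
                                      (sym (one-mate c-open (e-free , ce , trans ye (sym yc))))
      where
      yc = sound s c c∈s
      c-open = toOpen op (c∈s , unmatched op c∈s d-free cd)

    differ : ∀ {d e} → c ─ d → c ─ e → y d ≢ s → y e ≢ s → d ≡ e
    differ cd ce yd ye = one-opposite op (sound s c c∈s) cd ce (not-o (opp op) yd) (not-o (opp op) ye)

  -- Two of three free neighbours have the same colour. On side `s` they would be two mates of `c`,
  -- on side `o` two partners.
  few : Solve.Few G tfree S vs isClosed
  few {s} {o} op {c} {d} {e} {f} c∈s cd ce cf d≢e d≢f e≢f d-free e-free f-free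
    with y d ≟ᵇ s | y e ≟ᵇ s | y f ≟ᵇ s
  ... | yes yd | yes ye | _      = d≢e (same op c∈s d-free e-free cd ce yd ye)
  ... | yes yd | no _   | yes yf = d≢f (same op c∈s d-free f-free cd cf yd yf)
  ... | no _   | yes ye | yes yf = e≢f (same op c∈s e-free f-free ce cf ye yf)
  ... | no yd  | no ye  | _      = d≢e (differ op c∈s cd ce yd ye)
  ... | no yd  | yes _  | no yf  = d≢f (differ op c∈s cd cf yd yf)
  ... | yes _  | no ye  | no yf  = e≢f (differ op c∈s ce cf ye yf)

-- The fixed point of the rules

Includes : ∀ {n} → Subset n → Subset n → Set
Includes p q = ∀ i → lookup p i ≡ true → lookup q i ≡ true

grows : ∀ {n} (p q : Subset n) → Includes p q → p ≡ q ⊎ ∣ p ∣ < ∣ q ∣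
grows []          []          _   = inj₁ refl
grows (a ∷ p)     (b ∷ q)     inc with grows p q (inc ∘ suc)
grows (true ∷ p)  (true ∷ q)  inc | inj₁ refl = inj₁ refl
grows (true ∷ p)  (true ∷ q)  inc | inj₂ p<q  = inj₂ (s≤s p<q)
grows (true ∷ p)  (false ∷ q) inc | _ with inc 0F refl
... | ()
grows (false ∷ p) (true ∷ q)  inc | inj₁ refl = inj₂ ≤-refl
grows (false ∷ p) (true ∷ q)  inc | inj₂ p<q  = inj₂ (m≤n⇒m≤1+n p<q)
grows (false ∷ p) (false ∷ q) inc | inj₁ refl = inj₁ refl
grows (false ∷ p) (false ∷ q) inc | inj₂ p<q  = inj₂ p<q

module _ {n : ℕ} where

  weight : State n → ℕ
  weight (sets p q) = ∣ p ∣ + ∣ q ∣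

  weight≤ : ∀ S → weight S ≤ n + n
  weight≤ (sets p q) = +-mono-≤ (∣p∣≤n p) (∣p∣≤n q)

  _⊑_ : State n → State n → Set
  S ⊑ R = ∀ s → Includes (pick s S) (pick s R)

  ⊑-grows : ∀ {S R} → S ⊑ R → S ≡ R ⊎ weight S < weight R
  ⊑-grows {sets p q} {sets p′ q′} S⊑R with grows p p′ (S⊑R true) | grows q q′ (S⊑R false)
  ... | inj₁ refl | inj₁ refl = inj₁ refl
  ... | inj₁ refl | inj₂ q<q′ = inj₂ (+-monoʳ-< ∣ p ∣ q<q′)
  ... | inj₂ p<p′ | inj₁ refl = inj₂ (+-mono-<-≤ p<p′ ≤-refl)
  ... | inj₂ p<p′ | inj₂ q<q′ = inj₂ (+-mono-<-≤ p<p′ (≤-trans (m≤n⇒m≤1+n ≤-refl) q<q′))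

  module _ (f : State n → State n) (inflationary : ∀ S → S ⊑ f S) where

    iterate-fixed : ∀ m {S} → f S ≡ S → f (iterate f m S) ≡ iterate f m S
    iterate-fixed zero    eq = eq
    iterate-fixed (suc m) eq = iterate-fixed m (cong f eq)

    fixed-or-heavy : ∀ m S → let R = iterate f m S in f R ≡ R ⊎ m + weight S ≤ weight R
    fixed-or-heavy zero    S = inj₂ ≤-refl
    fixed-or-heavy (suc m) S with fixed-or-heavy m (f S) | ⊑-grows (inflationary S)
    ... | inj₁ eq    | _         = inj₁ eq
    ... | inj₂ _     | inj₁ S≡fS = inj₁ (iterate-fixed m (cong f (sym S≡fS)))
    ... | inj₂ heavy | inj₂ S<fS = inj₂ (begin
      suc m + weight S           ≡⟨ +-suc m (weight S) ⟨
      m + suc (weight S)         ≤⟨ +-monoʳ-≤ m S<fS ⟩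
      m + weight (f S)           ≤⟨ heavy ⟩
      weight (iterate f m (f S)) ∎)
      where open ≤-Reasoning

    -- Every round that changes the state increases its weight, and two sets of at most `n` vertices
    -- have weight at most `n + n`.
    iterate-stable : ∀ S → let R = iterate f (n + n) S in f R ≡ R
    iterate-stable S with fixed-or-heavy (n + n) S
    ... | inj₁ eq    = eq
    ... | inj₂ heavy with ⊑-grows (inflationary (iterate f (n + n) S))
    ...   | inj₁ eq  = sym eq
    ...   | inj₂ lt  = contradiction (≤-trans (m≤m+n (n + n) (weight S)) heavy) (<⇒≱ (≤-trans lt (weight≤ (f (iterate f (n + n) S)))))

    iterate-invariant : (I : State n → Set) → (∀ S → I S → I (f S)) → ∀ m S → I S → I (iterate f m S)
    iterate-invariant I pres zero    S i = i
    iterate-invariant I pres (suc m) S i = iterate-invariant I pres m (f S) (pres S i)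

-- The free variables are v, b and a, in this order.
start : Bool → Fm 3
start true  = 0F ≈ 2F
start false = 0F ≈ 1F

-- The first disjunct makes the step inflationary, on which the existence of the fixed point rests.
grow : Bool → Fm 3
grow s = 0F ∈ s ∨′ start s ∨′ rule s (not s)

unassigned : ∀ {k} → Fin k → Fm k
unassigned i = ¬′ (i ∈ true) ∧′ ¬′ (i ∈ false)

-- `exit` is necessary because the partner of a vertex of `s` lies outside `s`, `few` by the
-- counting argument.
exit few : ∀ {k} → Bool → Fm k
exit s = ∀′ (0F ∈ s ⇒ (∃′ (1F ~ 0F ∧′ ¬′ (0F ∈ s))))
few s = ∀′ (0F ∈ s ⇒ ¬′ (∃′ ∃′ ∃′ (3F ~ 2F ∧′ 3F ~ 1F ∧′ 3F ~ 0F ∧′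
          ¬′ (2F ≈ 1F) ∧′ ¬′ (2F ≈ 0F) ∧′ ¬′ (1F ≈ 0F) ∧′ unassigned 2F ∧′ unassigned 1F ∧′ unassigned 0F)))

accept : ∀ {k} → Fm k
accept = (∀′ ¬′ (0F ∈ true ∧′ 0F ∈ false)) ∧′ exit true ∧′ exit false ∧′ few true ∧′ few false

-- The first conjunct rejects the empty graph, which satisfies the second one vacuously but has no
-- cut into non-empty sides.
hasCut : Fm 0
hasCut = (∃′ (0F ≈ 0F)) ∧′ (∀′ ∃′ (1F ~ 0F ∧′ close grow accept))

module NextState (G : Graph) (vs : Vec (Fin (order G)) 2) where
  open Notation G
  open InState using (In)

  in⁺ : ∀ {S} s {v} → Sat (grow s) S (v ∷ vs) → In (next grow vs S) s v
  in⁺ {S@(sets _ _)} true  {v} p = trans (lookup∘tabulate _ v) (dec-true (sat? (grow true) S (v ∷ vs)) p)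
  in⁺ {S@(sets _ _)} false {v} p = trans (lookup∘tabulate _ v) (dec-true (sat? (grow false) S (v ∷ vs)) p)

  witness : ∀ {A : Set} (a? : Dec A) → does a? ≡ true → A
  witness (yes a) _ = a

  in⁻ : ∀ {S} s {v} → In (next grow vs S) s v → Sat (grow s) S (v ∷ vs)
  in⁻ {S@(sets _ _)} true  {v} p = witness (sat? (grow true) S (v ∷ vs)) (trans (sym (lookup∘tabulate _ v)) p)
  in⁻ {S@(sets _ _)} false {v} p = witness (sat? (grow false) S (v ∷ vs)) (trans (sym (lookup∘tabulate _ v)) p)

-- Stated for any f with the membership conditions of next grow, which is
-- costly to normalise.
module Closure (G : Graph) (a b : Fin (order G)) (ab : adj G a b ≡ true)
  (f : State (order G) → State (order G))
  (in⁺ : ∀ {S} s {v} → Semantics.Sat G (grow s) S (v ∷ b ∷ a ∷ []) → Notation.InState.In G (f S) s v)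
  (in⁻ : ∀ {S} s {v} → Notation.InState.In G (f S) s v → Semantics.Sat G (grow s) S (v ∷ b ∷ a ∷ []))
  where
  open Notation G

  vs : Vec V 2
  vs = b ∷ a ∷ []

  open InState using (In; Rooted; byMatch; byLock; byNbr)

  R : State n
  R = iterate f (n + n) ∅

  inflationary : ∀ S → S ⊑ f S
  inflationary S s v p = in⁺ s (inj₁ p)

  stable : f R ≡ R
  stable = iterate-stable f inflationary ∅

  grown : ∀ s {v} → Sat (grow s) R (v ∷ vs) → In R s v
  grown s {v} p = subst (λ Q → In Q s v) stable (in⁺ s p)

  ∅-empty : ∀ s v → ¬ In ∅ s v
  ∅-empty true  v p with trans (sym (lookup-replicate v false)) p
  ... | ()
  ∅-empty false v p with trans (sym (lookup-replicate v false)) p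
  ... | ()

  AllRooted : State n → Set
  AllRooted S = ∀ {s o v} → Opposite s o → In S s v → Rooted S s o v

  rooted-⊑ : ∀ {S S′ s o v} → S ⊑ S′ → Rooted S s o v → Rooted S′ s o v
  rooted-⊑ {o = o} inc (byMatch {w} w∈o vw)   = byMatch (inc o w w∈o) vw
  rooted-⊑ inc (byLock l)                     = byLock l
  rooted-⊑ {s = s} inc (byNbr {u} u∈s vu root) = byNbr (inc s u u∈s) vu (rooted-⊑ inc root)

  rule-rooted : ∀ {S s o v} → Opposite s o → AllRooted S → Sat (rule s o) S (v ∷ vs) → Rooted S s o v
  rule-rooted op root (inj₁ (u , w , u∈s , vu , _)) = byNbr u∈s vu (root op u∈s)
  rule-rooted op root (inj₂ (inj₁ (u , w , u∈s , _ , _ , vu , _))) = byNbr u∈s vu (root op u∈s)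
  rule-rooted op root (inj₂ (inj₂ (inj₁ (u , w , u∈s , vu , _)))) = byNbr u∈s vu (root op u∈s)
  rule-rooted op root (inj₂ (inj₂ (inj₂ (inj₁ (u , u∈o , vu , _))))) = byMatch u∈o vu
  rule-rooted op root (inj₂ (inj₂ (inj₂ (inj₂ (inj₁ (u , u∈o , vu , _)))))) = byMatch u∈o vu
  rule-rooted op root (inj₂ (inj₂ (inj₂ (inj₂ (inj₂ (inj₁ (c , _ , _ , _ , c∈s , _ , vc , _))))))) =
    byNbr c∈s vc (root op c∈s)
  rule-rooted op root (inj₂ (inj₂ (inj₂ (inj₂ (inj₂ (inj₂ (inj₁ (c , _ , _ , c∈o , vc , _)))))))) =
    byMatch c∈o vc
  rule-rooted op root (inj₂ (inj₂ (inj₂ (inj₂ (inj₂ (inj₂ (inj₂ (inj₁ (c , d , f , c∈o , l))))))))) =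
    byLock (c , d , f , lock-sym l)
  rule-rooted op root (inj₂ (inj₂ (inj₂ (inj₂ (inj₂ (inj₂ (inj₂ (inj₂ (c , _ , _ , _ , c∈s , vc , _))))))))) =
    byNbr c∈s vc (root op c∈s)

  f-rooted : ∀ S → AllRooted S → AllRooted (f S)
  f-rooted S root {s} {v = v} op v∈ with in⁻ s v∈
  ... | inj₁ v∈s = rooted-⊑ (inflationary S) (root op v∈s)
  -- The chains of reasons start here: `a` and `b` are both in the new state and match each other.
  f-rooted S root {s} tf v∈ | inj₂ (inj₁ refl) = byMatch (in⁺ false (inj₂ (inj₁ refl))) ab
  f-rooted S root {s} ft v∈ | inj₂ (inj₁ refl) = byMatch (in⁺ true (inj₂ (inj₁ refl))) (─-sym ab)
  f-rooted S root {s} tf v∈ | inj₂ (inj₂ r) = rooted-⊑ (inflationary S) (rule-rooted tf root r)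
  f-rooted S root {s} ft v∈ | inj₂ (inj₂ r) = rooted-⊑ (inflationary S) (rule-rooted ft root r)

  R-rooted : AllRooted R
  R-rooted = iterate-invariant f inflationary AllRooted f-rooted (n + n) ∅ λ {s} _ p → ⊥-elim (∅-empty s _ p)

  module _ (tfree : (T -Free) G) where
    open Closed G tfree R vs

    isClosed : (∀ v → ¬ (In R true v × In R false v)) →
               (∀ {s o} → Opposite s o → ∀ {c} → In R s c → ∃[ w ] c ─ w × ¬ In R s w) → IsClosed
    isClosed disjoint exits = record
      { closed = λ { tf r → grown true (inj₂ (inj₂ r)) ; ft r → grown false (inj₂ (inj₂ r)) }
      ; disjoint = λ { tf p q → disjoint _ (p , q) ; ft p q → disjoint _ (q , p) }
      ; rooted = R-rooted
      ; exits = λ op → exits op }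

    accept⇒solution : Sat accept (iterate f (n + n) ∅) (b ∷ a ∷ []) → SolutionOn G (_≡ a)
    accept⇒solution (disjoint , exitᵗ , exitᶠ , fewᵗ , fewᶠ) = Solve.local-solution G tfree R vs
      (isClosed disjoint λ { tf → exitᵗ _ ; ft → exitᶠ _ })
      (λ { tf c∈ cd ce cf d≢e d≢f e≢f d-free e-free f-free → fewᵗ _ c∈
             (_ , _ , _ , cd , ce , cf , d≢e , d≢f , e≢f , both d-free , both e-free , both f-free)
         ; ft c∈ cd ce cf d≢e d≢f e≢f d-free e-free f-free → fewᶠ _ c∈
             (_ , _ , _ , cd , ce , cf , d≢e , d≢f , e≢f , both d-free , both e-free , both f-free) })
      (grown true (inj₂ (inj₁ refl)))
      where
      open InState R using (Free)
      both : ∀ {v} → Free v → ¬ In R true v × ¬ In R false v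
      both v-free = v-free true , v-free false

    module _ (y : V → Bool) (proper : ∀ u → Proper G y u) (ya : y a ≡ true) (yb : y b ≡ false) where
      open Partner G y proper

      SoundState : State n → Set
      SoundState S = ∀ s v → In S s v → y v ≡ s

      f-sound : ∀ S → SoundState S → SoundState (f S)
      f-sound S sound s v v∈ with in⁻ s v∈
      f-sound S sound s     v v∈ | inj₁ v∈s         = sound s v v∈s
      f-sound S sound true  v v∈ | inj₂ (inj₁ refl) = ya
      f-sound S sound false v v∈ | inj₂ (inj₁ refl) = yb
      f-sound S sound true  v v∈ | inj₂ (inj₂ r)    = Sound.rule-sound S sound vs tf r
      f-sound S sound false v v∈ | inj₂ (inj₂ r)    = Sound.rule-sound S sound vs ft r

      R-sound : SoundState R
      R-sound = iterate-invariant f inflationary SoundState f-sound (n + n) ∅ λ s v p → ⊥-elim (∅-empty s v p)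

      solution⇒accept : Sat accept (iterate f (n + n) ∅) (b ∷ a ∷ [])
      solution⇒accept = disjoint , (λ _ → exits tf) , (λ _ → exits ft) , fewOf tf , fewOf ft
        where
        disjoint : ∀ v → ¬ (In R true v × In R false v)
        disjoint v (p , q) with trans (sym (R-sound true v p)) (R-sound false v q)
        ... | ()
        exits : ∀ {s o} → Opposite s o → ∀ {c} → In R s c → ∃[ w ] c ─ w × ¬ In R s w
        exits {s} op {c} c∈s = partner c , partner-adj c , λ p →
          clash op (trans (sym (R-sound s _ p)) (partner-o op (R-sound s c c∈s)))
        open InState R using (Free; free)
        fewOf : ∀ {s o} → Opposite s o → Sat (few s) R vs
        fewOf op c c∈ (_ , _ , _ , cd , ce , cf , d≢e , d≢f , e≢f , (p , q) , (p′ , q′) , (p″ , q″)) =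
          Counting.few G tfree R vs (isClosed disjoint exits) y proper R-sound op c∈ cd ce cf d≢e d≢f e≢f
            (free tf p q) (free tf p′ q′) (free tf p″ q″)

-- The criterion characterises perfect matching cuts

proper-not : ∀ {G y u} → Proper G y u → Proper G (not ∘ y) u
proper-not (w , (uw , yw) , unique) = w , (uw , cong not yw) ,
  λ (uv , yv) → unique (uv , trans (sym (not-involutive _)) (trans (cong not yv) (not-involutive _)))

module _ (G : Graph) (tfree : (T -Free) G) (a : Fin (order G)) where
  open Semantics G

  branch : Fm 1
  branch = ∃′ (1F ~ 0F ∧′ close grow accept)

  branch⇒local : Sat branch ∅ (a ∷ []) → SolutionOn G (_≡ a)
  branch⇒local (b , ab , acc) = accept⇒solution tfree acc
    where
    open NextState G (b ∷ a ∷ [])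
    open Closure G a b ab (next grow (b ∷ a ∷ [])) in⁺ in⁻

  proper⇒branch : ∀ y → (∀ u → Proper G y u) → Sat branch ∅ (a ∷ [])
  proper⇒branch y proper = go (proper a)
    where
    go : Proper G y a → Sat branch ∅ (a ∷ [])
    go (b , (ab , yb) , _) = b , ab , accepted (y a) refl
      where
      open NextState G (b ∷ a ∷ [])
      open Closure G a b ab (next grow (b ∷ a ∷ [])) in⁺ in⁻
      accepted : ∀ c → y a ≡ c → Sat (close grow accept) ∅ (b ∷ a ∷ [])
      accepted true  ya = solution⇒accept tfree y proper ya (trans yb (cong not ya))
      -- `start` puts `a` on side `true`; a colouring with the opposite convention is inverted
      -- first.
      accepted false ya = solution⇒accept tfree (not ∘ y) (λ u → proper-not {G} {y} (proper u))
                            (cong not ya) (cong not (trans yb (cong not ya)))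

hasCut-sound : ∀ G → (T -Free) G → Semantics.Sat G hasCut ∅ [] → HasPerfectMatchingCut G
hasCut-sound G tfree ((v₀ , _) , branches) = proper⇒cut x (λ u → proper (covers (toℕ<n u))) v₀
  where
  open SolutionOn (glue (λ a → branch⇒local G tfree a (branches a)) (order G) ≤-refl)

hasCut-complete : ∀ G → (T -Free) G → Fin (order G) → ∀ y → (∀ u → Proper G y u) → Semantics.Sat G hasCut ∅ []
hasCut-complete G tfree v₀ y proper = (v₀ , refl) , λ a → proper⇒branch G tfree a y proper

theorem5 : PolynomialTime (PERFECT-MATCHING-CUT ↾ (T -Free))
theorem5 = definable⇒polynomial hasCut (T -Free) HasPerfectMatchingCut λ G tfree → mk⇔
  (λ cut → hasCut-complete G tfree (proj₁ (Cut.nonemptyX (proj₁ cut)))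
             (proj₁ (cut⇒proper cut)) (proj₂ (cut⇒proper cut)))
  (hasCut-sound G tfree)
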